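{- Let $H(a_1, a_2, \ldots, a_n)=\sum_{j=0}^m c_j h_j(a_1, a_2, \ldots, a_n)$ with real coefficients $c_j$ and let $-\infty \le r < s \le \infty$. Then $$H(a_1, \ldots, a_n) >0\quad\text{for all}\quad (a_1,\ldots,a_n) \in (r,s)^n\setminus\{(0,\ldots,0)\}$$ if and only if $H(a,a, \ldots,a) >0$ for all $a \in (r,s)\setminus\{0\}$.
   Context: For a nonnegative integer $j$, $h_j(a_1,\ldots,a_n)=\sum_{1\le i_1\le i_2\le\cdots\le i_j\le n}a_{i_1}a_{i_2}\cdots a_{i_j}$ is the complete homogeneous symmetric polynomial of degree $j$ in $n$ variables, with $h_0=1$. Here $n\ge1$ and $m\ge 0$ are integers, and $(r,s)\subset\mathbb{R}$ is an open interval, possibly unbounded. -}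

module Defs where

open import Data.Fin.Base as Fin using (Fin; toℕ)
import Data.Fin.Properties as Fin
open import Data.List.Base using (List; []; _∷_; map; filter; foldr; tabulate; allFin; cartesianProductWith)
open import Data.List.Relation.Unary.Linked using (linked?)
open import Data.Nat.Base as ℕ using (ℕ; zero; suc)
import Data.Nat.Properties as ℕ
open import Data.Product.Base using (_×_; _,_; proj₁; proj₂; ∃-syntax)
open import Data.Rational.Base as ℚ using (ℚ; 0ℚ; 1ℚ; ½; ∣_∣)
import Data.Rational.Properties as ℚ
open import Data.Rational.Solver using (module +-*-Solver)
open import Data.Sum.Base using (_⊎_; inj₁; inj₂)
open import Data.Vec.Functional using (Vector)
open import Level using (0ℓ)
open import Relation.Binary.Core using (Rel)
open import Relation.Binary.Definitions using (Tight)
open import Relation.Binary.PropositionalEquality using (_≡_; refl; sym; trans; cong; cong₂; subst; subst₂)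
open import Relation.Nullary using (¬_; yes; no; contradiction)
open import Relation.Nullary.Construct.Add.Extrema using (_±; [_])

open +-*-Solver using (solve; con; _:+_; _:*_; _:-_; :-_; _:=_)

IsCauchy : (ℕ → ℚ) → Set
IsCauchy u = ∀ ε → 0ℚ ℚ.< ε →
  ∃[ N ] (∀ m n → N ℕ.≤ m → N ℕ.≤ n → ∣ u m ℚ.- u n ∣ ℚ.< ε)

-- Real equality is the setoid equality _≈_ below, not _≡_.
record ℝ : Set where
  constructor mkℝ
  field
    seq    : ℕ → ℚ
    cauchy : IsCauchy seq

open ℝ public

infix 4 _≈_ _<_ _#_

_≈_ : Rel ℝ 0ℓ
x ≈ y = ∀ ε → 0ℚ ℚ.< ε →
  ∃[ N ] (∀ n → N ℕ.≤ n → ∣ seq x n ℚ.- seq y n ∣ ℚ.< ε)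

_<_ : Rel ℝ 0ℓ
x < y = ∃[ ε ] (0ℚ ℚ.< ε ×
  ∃[ N ] (∀ n → N ℕ.≤ n → seq x n ℚ.+ ε ℚ.< seq y n))

-- Inequality of reals in its positive form: ¬ (x # y) is equivalent to
-- x ≈ y (#-tight), so classically x # y is ¬ (x ≈ y).
_#_ : Rel ℝ 0ℓ
x # y = x < y ⊎ y < x

0<1 : 0ℚ ℚ.< 1ℚ
0<1 = ℚ.positive⁻¹ 1ℚ

*-pos : ∀ {p q} → 0ℚ ℚ.< p → 0ℚ ℚ.< q → 0ℚ ℚ.< p ℚ.* q
*-pos {p} {q} 0<p 0<q = ℚ.positive⁻¹ (p ℚ.* q)
  {{ℚ.pos*pos⇒pos p {{ℚ.positive 0<p}} q {{ℚ.positive 0<q}}}}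

half-pos : ∀ {ε} → 0ℚ ℚ.< ε → 0ℚ ℚ.< ½ ℚ.* ε
half-pos = *-pos (ℚ.positive⁻¹ ½)

half+half : ∀ ε → ½ ℚ.* ε ℚ.+ ½ ℚ.* ε ≡ ε
half+half ε = solve 1 (λ e → con ½ :* e :+ con ½ :* e := e) refl ε

bounded : ∀ {u} → IsCauchy u →
  ∃[ B ] (0ℚ ℚ.< B × ∃[ N ] (∀ n → N ℕ.≤ n → ∣ u n ∣ ℚ.≤ B))
bounded {u} cu with cu 1ℚ 0<1
... | N , close = ∣ u N ∣ ℚ.+ 1ℚ
                , ℚ.+-mono-≤-< (ℚ.0≤∣p∣ (u N)) 0<1
                , N , bound
  where
  open ℚ.≤-Reasoning
  bound : ∀ n → N ℕ.≤ n → ∣ u n ∣ ℚ.≤ ∣ u N ∣ ℚ.+ 1ℚ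
  bound n N≤n = begin
    ∣ u n ∣                        ≡⟨ cong ∣_∣ (solve 2 (λ a b → a := b :+ (a :- b)) refl (u n) (u N)) ⟩
    ∣ u N ℚ.+ (u n ℚ.- u N) ∣      ≤⟨ ℚ.∣p+q∣≤∣p∣+∣q∣ (u N) (u n ℚ.- u N) ⟩
    ∣ u N ∣ ℚ.+ ∣ u n ℚ.- u N ∣    ≤⟨ ℚ.+-monoʳ-≤ ∣ u N ∣ (ℚ.<⇒≤ (close n N N≤n ℕ.≤-refl)) ⟩
    ∣ u N ∣ ℚ.+ 1ℚ                 ∎

divide : ∀ C ε → 0ℚ ℚ.< C → 0ℚ ℚ.< ε → ∃[ δ ] (0ℚ ℚ.< δ × C ℚ.* δ ≡ ε)
divide C ε 0<C 0<ε = ε ℚ.* ℚ.1/ C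
  , *-pos 0<ε (ℚ.positive⁻¹ (ℚ.1/ C) {{ℚ.1/pos⇒pos C}})
  , trans (ℚ.*-comm C (ε ℚ.* ℚ.1/ C))
      (trans (ℚ.*-assoc ε (ℚ.1/ C) C)
        (trans (cong (ε ℚ.*_) (ℚ.*-inverseˡ C)) (ℚ.*-identityʳ ε)))
  where
  instance
    C-pos : ℚ.Positive C
    C-pos = ℚ.positive 0<C
    C-nonZero : ℚ.NonZero C
    C-nonZero = ℚ.pos⇒nonZero C

product-close : ∀ a b c d A B δ → 0ℚ ℚ.< A → 0ℚ ℚ.< B →
  ∣ a ∣ ℚ.≤ A → ∣ d ∣ ℚ.≤ B → ∣ b ℚ.- d ∣ ℚ.< δ → ∣ a ℚ.- c ∣ ℚ.< δ →
  ∣ a ℚ.* b ℚ.- c ℚ.* d ∣ ℚ.< (A ℚ.+ B) ℚ.* δ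
product-close a b c d A B δ 0<A 0<B a≤A d≤B b-d a-c = begin-strict
  ∣ a ℚ.* b ℚ.- c ℚ.* d ∣
    ≡⟨ cong ∣_∣ (solve 4 (λ a b c d → a :* b :- c :* d := a :* (b :- d) :+ d :* (a :- c)) refl a b c d) ⟩
  ∣ a ℚ.* (b ℚ.- d) ℚ.+ d ℚ.* (a ℚ.- c) ∣
    ≤⟨ ℚ.∣p+q∣≤∣p∣+∣q∣ (a ℚ.* (b ℚ.- d)) (d ℚ.* (a ℚ.- c)) ⟩
  ∣ a ℚ.* (b ℚ.- d) ∣ ℚ.+ ∣ d ℚ.* (a ℚ.- c) ∣
    ≡⟨ cong₂ ℚ._+_ (ℚ.∣p*q∣≡∣p∣*∣q∣ a (b ℚ.- d)) (ℚ.∣p*q∣≡∣p∣*∣q∣ d (a ℚ.- c)) ⟩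
  ∣ a ∣ ℚ.* ∣ b ℚ.- d ∣ ℚ.+ ∣ d ∣ ℚ.* ∣ a ℚ.- c ∣
    ≤⟨ ℚ.+-mono-≤ (ℚ.*-monoʳ-≤-nonNeg ∣ b ℚ.- d ∣ {{ℚ.∣-∣-nonNeg (b ℚ.- d)}} a≤A)
                  (ℚ.*-monoʳ-≤-nonNeg ∣ a ℚ.- c ∣ {{ℚ.∣-∣-nonNeg (a ℚ.- c)}} d≤B) ⟩
  A ℚ.* ∣ b ℚ.- d ∣ ℚ.+ B ℚ.* ∣ a ℚ.- c ∣
    <⟨ ℚ.+-mono-< (ℚ.*-monoʳ-<-pos A {{ℚ.positive 0<A}} b-d)
                  (ℚ.*-monoʳ-<-pos B {{ℚ.positive 0<B}} a-c) ⟩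
  A ℚ.* δ ℚ.+ B ℚ.* δ
    ≡⟨ ℚ.*-distribʳ-+ δ A B ⟨
  (A ℚ.+ B) ℚ.* δ ∎
  where open ℚ.≤-Reasoning

abstract

  const-cauchy : ∀ q → IsCauchy (λ _ → q)
  const-cauchy q ε 0<ε = 0 , λ _ _ _ _ →
    subst (ℚ._< ε) (sym (cong ∣_∣ (ℚ.+-inverseʳ q))) 0<ε

  +-cauchy : ∀ u v → IsCauchy u → IsCauchy v → IsCauchy (λ n → u n ℚ.+ v n)
  +-cauchy u v cu cv ε 0<ε
    with cu (½ ℚ.* ε) (half-pos 0<ε) | cv (½ ℚ.* ε) (half-pos 0<ε)
  ... | M , closeᵤ | N , closeᵥ = M ℕ.⊔ N , λ m n K≤m K≤n → begin-strict
      ∣ (u m ℚ.+ v m) ℚ.- (u n ℚ.+ v n) ∣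
        ≡⟨ cong ∣_∣ (solve 4 (λ a b c d → (a :+ b) :- (c :+ d) := (a :- c) :+ (b :- d)) refl (u m) (v m) (u n) (v n)) ⟩
      ∣ (u m ℚ.- u n) ℚ.+ (v m ℚ.- v n) ∣
        ≤⟨ ℚ.∣p+q∣≤∣p∣+∣q∣ (u m ℚ.- u n) (v m ℚ.- v n) ⟩
      ∣ u m ℚ.- u n ∣ ℚ.+ ∣ v m ℚ.- v n ∣
        <⟨ ℚ.+-mono-< (closeᵤ m n (ℕ.m⊔n≤o⇒m≤o M N K≤m) (ℕ.m⊔n≤o⇒m≤o M N K≤n))
                      (closeᵥ m n (ℕ.m⊔n≤o⇒n≤o M N K≤m) (ℕ.m⊔n≤o⇒n≤o M N K≤n)) ⟩
      ½ ℚ.* ε ℚ.+ ½ ℚ.* ε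
        ≡⟨ half+half ε ⟩
      ε ∎
    where open ℚ.≤-Reasoning

  *-cauchy : ∀ u v → IsCauchy u → IsCauchy v → IsCauchy (λ n → u n ℚ.* v n)
  *-cauchy u v cu cv ε 0<ε =
    let A , 0<A , M₁ , u≤A = bounded cu
        B , 0<B , N₁ , v≤B = bounded cv
        δ , 0<δ , Cδ≡ε     = divide (A ℚ.+ B) ε (ℚ.+-mono-< 0<A 0<B) 0<ε
        M₂ , closeᵤ        = cu δ 0<δ
        N₂ , closeᵥ        = cv δ 0<δ
        M = M₁ ℕ.⊔ M₂
        N = N₁ ℕ.⊔ N₂
    in M ℕ.⊔ N , λ m n K≤m K≤n →
      let M≤m = ℕ.m⊔n≤o⇒m≤o M N K≤m
          M≤n = ℕ.m⊔n≤o⇒m≤o M N K≤n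
          N≤m = ℕ.m⊔n≤o⇒n≤o M N K≤m
          N≤n = ℕ.m⊔n≤o⇒n≤o M N K≤n
      in subst (∣ u m ℚ.* v m ℚ.- u n ℚ.* v n ∣ ℚ.<_) Cδ≡ε
        (product-close (u m) (v m) (u n) (v n) A B δ 0<A 0<B
          (u≤A m (ℕ.m⊔n≤o⇒m≤o M₁ M₂ M≤m)) (v≤B n (ℕ.m⊔n≤o⇒m≤o N₁ N₂ N≤n))
          (closeᵥ m n (ℕ.m⊔n≤o⇒n≤o N₁ N₂ N≤m) (ℕ.m⊔n≤o⇒n≤o N₁ N₂ N≤n))
          (closeᵤ m n (ℕ.m⊔n≤o⇒n≤o M₁ M₂ M≤m) (ℕ.m⊔n≤o⇒n≤o M₁ M₂ M≤n)))

0ℝ 1ℝ : ℝ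
0ℝ = mkℝ (λ _ → 0ℚ) (const-cauchy 0ℚ)
1ℝ = mkℝ (λ _ → 1ℚ) (const-cauchy 1ℚ)

infixl 6 _+_
infixl 7 _*_

_+_ _*_ : ℝ → ℝ → ℝ
x + y = mkℝ (λ n → seq x n ℚ.+ seq y n) (+-cauchy (seq x) (seq y) (cauchy x) (cauchy y))
x * y = mkℝ (λ n → seq x n ℚ.* seq y n) (*-cauchy (seq x) (seq y) (cauchy x) (cauchy y))

p≤∣p∣ : ∀ p → p ℚ.≤ ∣ p ∣
p≤∣p∣ p with ℚ.≤-total 0ℚ p
... | inj₁ 0≤p = ℚ.≤-reflexive (sym (ℚ.0≤p⇒∣p∣≡p 0≤p))
... | inj₂ p≤0 = ℚ.≤-trans p≤0 (ℚ.0≤∣p∣ p)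

-[p-q]≡q-p : ∀ p q → ℚ.- (p ℚ.- q) ≡ q ℚ.- p
-[p-q]≡q-p = solve 2 (λ a b → :- (a :- b) := b :- a) refl

∣p-q∣≡∣q-p∣ : ∀ p q → ∣ p ℚ.- q ∣ ≡ ∣ q ℚ.- p ∣
∣p-q∣≡∣q-p∣ p q = trans (sym (ℚ.∣-p∣≡∣p∣ (p ℚ.- q))) (cong ∣_∣ (-[p-q]≡q-p p q))

-- A gap of ε at one index n persists, as a gap of ε / 4, at all later ones.
gap⇒< : ∀ x y ε → (0<ε : 0ℚ ℚ.< ε) →
  let δ = ½ ℚ.* (½ ℚ.* ε) ; 0<δ = half-pos (half-pos 0<ε) in
  ∀ n → cauchy x δ 0<δ .proj₁ ℕ.≤ n →
        cauchy y δ 0<δ .proj₁ ℕ.≤ n →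
  ε ℚ.≤ seq y n ℚ.- seq x n → x < y
gap⇒< x y ε 0<ε n M≤n N≤n gap = δ , 0<δ , n , λ m n≤m →
    let xm = seq x m ; xn = seq x n ; ym = seq y m ; yn = seq y n
        X = ℚ.≤-<-trans (p≤∣p∣ (xm ℚ.- xn))
              (cauchy x δ 0<δ .proj₂ m n (ℕ.≤-trans M≤n n≤m) M≤n)
        Y = ℚ.≤-<-trans (p≤∣p∣ (yn ℚ.- ym))
              (cauchy y δ 0<δ .proj₂ n m N≤n (ℕ.≤-trans N≤n n≤m))
    in begin-strict
      xm ℚ.+ δ
        ≡⟨ solve 5 (λ a b c d e → a :+ e := ((a :- b) :+ (d :- c)) :+ (e :+ b :+ c :- d)) refl xm xn ym yn δ ⟩
      ((xm ℚ.- xn) ℚ.+ (yn ℚ.- ym)) ℚ.+ (δ ℚ.+ xn ℚ.+ ym ℚ.- yn)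
        <⟨ ℚ.+-monoˡ-< (δ ℚ.+ xn ℚ.+ ym ℚ.- yn) (ℚ.+-mono-< X Y) ⟩
      (δ ℚ.+ δ) ℚ.+ (δ ℚ.+ xn ℚ.+ ym ℚ.- yn)
        ≡⟨ solve 4 (λ b c d e → (e :+ e) :+ (e :+ b :+ c :- d) := (e :+ e :+ e) :+ (b :+ c :- d)) refl xn ym yn δ ⟩
      (δ ℚ.+ δ ℚ.+ δ) ℚ.+ (xn ℚ.+ ym ℚ.- yn)
        <⟨ ℚ.+-monoˡ-< (xn ℚ.+ ym ℚ.- yn) 3δ<ε ⟩
      ε ℚ.+ (xn ℚ.+ ym ℚ.- yn)
        ≤⟨ ℚ.+-monoˡ-≤ (xn ℚ.+ ym ℚ.- yn) gap ⟩
      (yn ℚ.- xn) ℚ.+ (xn ℚ.+ ym ℚ.- yn)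
        ≡⟨ solve 3 (λ b c d → (d :- b) :+ (b :+ c :- d) := c) refl xn ym yn ⟩
      ym ∎
  where
  open ℚ.≤-Reasoning
  δ : ℚ
  δ = ½ ℚ.* (½ ℚ.* ε)
  0<δ : 0ℚ ℚ.< δ
  0<δ = half-pos (half-pos 0<ε)
  3δ<ε : δ ℚ.+ δ ℚ.+ δ ℚ.< ε
  3δ<ε = subst₂ ℚ._<_ (ℚ.+-identityʳ _)
    (solve 1 (λ e → let d = con ½ :* (con ½ :* e) in d :+ d :+ d :+ d := e) refl ε)
    (ℚ.+-monoʳ-< (δ ℚ.+ δ ℚ.+ δ) 0<δ)

<⇒≉ : ∀ x y → x < y → ¬ (x ≈ y) × ¬ (y ≈ x)
<⇒≉ x y (ε , 0<ε , N , gap) = far , λ y≈x → far λ e 0<e → let K , close = y≈x e 0<e in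
    K , λ n K≤n → subst (ℚ._< e) (∣p-q∣≡∣q-p∣ (seq y n) (seq x n)) (close n K≤n)
  where
  open ℚ.≤-Reasoning
  far : ¬ (x ≈ y)
  far x≈y with x≈y ε 0<ε
  ... | M , close = ℚ.<-irrefl refl (begin-strict
      yK                        ≡⟨ solve 2 (λ a b → b := a :+ (b :- a)) refl xK yK ⟩
      xK ℚ.+ (yK ℚ.- xK)        ≤⟨ ℚ.+-monoʳ-≤ xK p≤ ⟩
      xK ℚ.+ ∣ xK ℚ.- yK ∣      <⟨ ℚ.+-monoʳ-< xK (close K (ℕ.m≤m⊔n M N)) ⟩
      xK ℚ.+ ε                  <⟨ gap K (ℕ.m≤n⊔m M N) ⟩
      yK                        ∎)
    where
    K = M ℕ.⊔ N
    xK = seq x K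
    yK = seq y K
    p≤ : yK ℚ.- xK ℚ.≤ ∣ xK ℚ.- yK ∣
    p≤ = subst (yK ℚ.- xK ℚ.≤_) (∣p-q∣≡∣q-p∣ yK xK) (p≤∣p∣ (yK ℚ.- xK))

#-tight : Tight _≈_ _#_
#-tight x y = ¬#⇒≈ , λ where
    x≈y (inj₁ x<y) → <⇒≉ x y x<y .proj₁ x≈y
    x≈y (inj₂ y<x) → <⇒≉ y x y<x .proj₂ x≈y
  where
  ¬#⇒≈ : ¬ (x # y) → x ≈ y
  ¬#⇒≈ ¬x#y ε 0<ε = M ℕ.⊔ N , close
    where
    δ = ½ ℚ.* (½ ℚ.* ε)
    0<δ = half-pos (half-pos 0<ε)
    M = cauchy x δ 0<δ .proj₁
    N = cauchy y δ 0<δ .proj₁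
    close : ∀ n → M ℕ.⊔ N ℕ.≤ n → ∣ seq x n ℚ.- seq y n ∣ ℚ.< ε
    close n K≤n with ∣ seq x n ℚ.- seq y n ∣ ℚ.<? ε | ℚ.∣p∣≡p∨∣p∣≡-p (seq x n ℚ.- seq y n)
    ... | yes p | _       = p
    ... | no ¬p | inj₁ eq = contradiction
      (inj₂ (gap⇒< y x ε 0<ε n (ℕ.m⊔n≤o⇒n≤o M N K≤n) (ℕ.m⊔n≤o⇒m≤o M N K≤n)
        (subst (ε ℚ.≤_) eq (ℚ.≮⇒≥ ¬p)))) ¬x#y
    ... | no ¬p | inj₂ eq = contradiction
      (inj₁ (gap⇒< x y ε 0<ε n (ℕ.m⊔n≤o⇒m≤o M N K≤n) (ℕ.m⊔n≤o⇒n≤o M N K≤n)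
        (subst (ε ℚ.≤_)
          (trans eq (-[p-q]≡q-p (seq x n) (seq y n)))
          (ℚ.≮⇒≥ ¬p)))) ¬x#y

open import Relation.Binary.Construct.Add.Extrema.Strict _<_ public using (_<±_)

infix 4 _∈⟨_,_⟩

_∈⟨_,_⟩ : ℝ → ℝ ± → ℝ ± → Set
x ∈⟨ r , s ⟩ = r <± [ x ] × [ x ] <± s

∑ ∏ : List ℝ → ℝ
∑ = foldr _+_ 0ℝ
∏ = foldr _*_ 1ℝ

sequences : ∀ n → ℕ → List (List (Fin n))
sequences n zero    = [] ∷ []
sequences n (suc j) = cartesianProductWith _∷_ (allFin n) (sequences n j)

weaklyIncreasing : ∀ n → ℕ → List (List (Fin n))
weaklyIncreasing n j = filter (linked? Fin._≤?_) (sequences n j)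

-- The indices i₁ ≤ … ≤ iⱼ range over Fin n.  The empty sequence is the only
-- one of length 0, so h 0 a ≈ 1ℝ also for n = 0.
h : ∀ {n} → ℕ → Vector ℝ n → ℝ
h {n} j a = ∑ (map (λ is → ∏ (map a is)) (weaklyIncreasing n j))

H : ∀ {n m} → Vector ℝ (suc m) → Vector ℝ n → ℝ
H c a = ∑ (tabulate (λ j → c j * h (toℕ j) a))

{-# OPTIONS --safe #-}
module Submission where

-- Divided differences give h_j(x,Z) - h_j(y,Z) = (x - y) h_{j-1}(x,y,Z), and hence knot
-- insertion: if c divides the segment from a to b in the ratio κ : 1, then
-- (κ + 1) H(a,b,Z) = κ H(a,c,Z) + H(c,b,Z).
--
-- H ≥ 0: suppose H(A,y,…,y) ≥ 0 for all y, with p + 1 copies of y.  Moving from a to x in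
-- N small steps b, insertion of the previous point bounds H(A,a,b,…,b) below by
-- its value at the previous step and by values of H at (A, almost constant), which are at
-- least -O(1/N).  So H(A,a,x,…,x) ≥ 0, and the entries become arbitrary one at a time.
--
-- H > 0: if y is an entry apart from 0, contract the other entries towards y until H is
-- positive by continuity.  Undoing the contraction of x to c expresses H(y,x,Z) as a
-- combination, with positive weights, of H(y,c,Z) > 0 and H(c,x,Z) ≥ 0.
--
-- All estimates are made for the rational terms of the Cauchy sequences, at all large
-- indices.

open import Defs
open import Data.Bool.Base using (true; false; if_then_else_)
open import Data.Fin.Base as Fin using (Fin; zero; suc; toℕ)
import Data.Fin.Properties as Fin
import Data.Integer.Base as ℤ
import Data.Integer.Properties as ℤ
open import Data.List.Base as List
  using (List; []; _∷_; _++_; map; filter; tabulate; allFin; length; drop; cartesianProductWith)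
open import Data.List.Membership.Propositional.Properties using (∈-∃++; ∈-tabulate⁺)
open import Data.List.Properties
  using (length-++; ++-assoc; ++-identityʳ; map-++; filter-++; map-replicate; map-tabulate;
         length-map; length-replicate; length-tabulate)
open import Data.List.Relation.Binary.Permutation.Propositional as Perm
  using (_↭_; prep; swap; ↭-sym; ↭-trans; ↭-reflexive)
open import Data.List.Relation.Binary.Permutation.Propositional.Properties
  using (shift; shifts; map⁺; ↭-length; All-resp-↭)
open import Data.List.Relation.Unary.All as All using (All; []; _∷_)
import Data.List.Relation.Unary.All.Properties as All
open import Data.List.Relation.Unary.Linked using (linked?)
open import Data.Nat.Base as ℕ using (ℕ; zero; suc) renaming (_≤_ to _≤ℕ_)
import Data.Nat.Properties as ℕ
open import Data.Product.Base using (∃-syntax; _×_; _,_; proj₁; proj₂)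
open import Data.Rational.Base as ℚ using (ℚ; 0ℚ; 1ℚ; ½; ∣_∣)
import Data.Rational.Properties as ℚ
open import Data.Rational.Solver using (module +-*-Solver)
open import Data.Rational.Unnormalised.Base as ℚᵘ using (mkℚᵘ; *≡*; *≤*)
import Data.Rational.Unnormalised.Properties as ℚᵘ
open import Data.Sum.Base using (_⊎_; inj₁; inj₂; [_,_]′)
open import Data.Vec.Functional using (Vector; replicate)
open import Function.Base using (_∘_)
open import Function.Bundles using (_⇔_; mk⇔)
open import Relation.Binary.Construct.Add.Extrema.Strict _<_
  using (⊥±<[_]; [_]<⊤±) renaming ([_] to ⟦_⟧)
open import Relation.Binary.PropositionalEquality
  using (_≡_; refl; sym; trans; cong; cong₂; subst; subst₂; _≗_; module ≡-Reasoning)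
open import Relation.Nullary using (does; yes; no)
open import Relation.Nullary.Construct.Add.Extrema using (_±; [_])

open +-*-Solver using (solve; con; _:+_; _:*_; _:-_; :-_; _:=_)

-- Complete homogeneous polynomials over lists of rationals

-- Sorts the monomials by whether they contain the first variable; after one factor `x` is split
-- off, `x` stays in the list because it may occur again.
hᴸ : ℕ → List ℚ → ℚ
hᴸ zero    _        = 1ℚ
hᴸ (suc j) []       = 0ℚ
hᴸ (suc j) (x ∷ xs) = x ℚ.* hᴸ j (x ∷ xs) ℚ.+ hᴸ (suc j) xs

-- h⁻ j is h of degree j - 1, with h of degree -1 equal to 0.
h⁻ : ℕ → List ℚ → ℚ
h⁻ zero    _  = 0ℚ
h⁻ (suc j) xs = hᴸ j xs

-- Induction on `j`, unfolding both sides once. Degree 1 is a case of its own because the quotient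
-- is then the constant 1, to which the recursion of `hᴸ` in `x` does not apply.
hᴸ-diff : ∀ j x y zs → hᴸ j (x ∷ zs) ℚ.- hᴸ j (y ∷ zs) ≡ (x ℚ.- y) ℚ.* h⁻ j (x ∷ y ∷ zs)
hᴸ-diff zero x y zs =
  solve 2 (λ x y → con 1ℚ :- con 1ℚ := (x :- y) :* con 0ℚ) refl x y
hᴸ-diff (suc zero) x y zs =
  solve 3 (λ x y t → (x :* con 1ℚ :+ t) :- (y :* con 1ℚ :+ t) := (x :- y) :* con 1ℚ)
    refl x y (hᴸ 1 zs)
hᴸ-diff (suc (suc j)) x y zs = begin
  (x ℚ.* u ℚ.+ t) ℚ.- (y ℚ.* v ℚ.+ t)
    ≡⟨ solve 5 (λ x y u v t → (x :* u :+ t) :- (y :* v :+ t) := x :* (u :- v) :+ (x :- y) :* v)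
         refl x y u v t ⟩
  x ℚ.* (u ℚ.- v) ℚ.+ (x ℚ.- y) ℚ.* v
    ≡⟨ cong (λ d → x ℚ.* d ℚ.+ (x ℚ.- y) ℚ.* v) (hᴸ-diff (suc j) x y zs) ⟩
  x ℚ.* ((x ℚ.- y) ℚ.* w) ℚ.+ (x ℚ.- y) ℚ.* v
    ≡⟨ solve 4 (λ x y w v → x :* ((x :- y) :* w) :+ (x :- y) :* v := (x :- y) :* (x :* w :+ v))
         refl x y w v ⟩
  (x ℚ.- y) ℚ.* (x ℚ.* w ℚ.+ v) ∎
  where
  open ≡-Reasoning
  u = hᴸ (suc j) (x ∷ zs)
  v = hᴸ (suc j) (y ∷ zs)
  w = hᴸ j (x ∷ y ∷ zs)
  t = hᴸ (suc (suc j)) zs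

-- Unfolding on `x` or on `y` gives results that differ by `(x - y) u` minus a difference of the
-- kind in `hᴸ-diff`, and these two cancel. The induction hypothesis then swaps the entries inside
-- `u`.
hᴸ-swap : ∀ j x y zs → hᴸ j (x ∷ y ∷ zs) ≡ hᴸ j (y ∷ x ∷ zs)
hᴸ-swap zero    x y zs = refl
hᴸ-swap (suc j) x y zs = begin
  x ℚ.* u ℚ.+ (y ℚ.* p ℚ.+ t)
    ≡⟨ solve 6 (λ x y u p q t → x :* u :+ (y :* p :+ t) :=
         y :* u :+ (x :* q :+ t) :+ ((x :- y) :* u :- ((x :* q :+ t) :- (y :* p :+ t))))
         refl x y u p q t ⟩
  y ℚ.* u ℚ.+ (x ℚ.* q ℚ.+ t) ℚ.+ ((x ℚ.- y) ℚ.* u ℚ.- (hᴸ (suc j) (x ∷ zs) ℚ.- hᴸ (suc j) (y ∷ zs)))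
    ≡⟨ cong (λ d → y ℚ.* u ℚ.+ (x ℚ.* q ℚ.+ t) ℚ.+ ((x ℚ.- y) ℚ.* u ℚ.- d)) (hᴸ-diff (suc j) x y zs) ⟩
  y ℚ.* u ℚ.+ (x ℚ.* q ℚ.+ t) ℚ.+ ((x ℚ.- y) ℚ.* u ℚ.- (x ℚ.- y) ℚ.* u)
    ≡⟨ solve 2 (λ s d → s :+ (d :- d) := s) refl (y ℚ.* u ℚ.+ (x ℚ.* q ℚ.+ t)) ((x ℚ.- y) ℚ.* u) ⟩
  y ℚ.* u ℚ.+ (x ℚ.* q ℚ.+ t)
    ≡⟨ cong (λ d → y ℚ.* d ℚ.+ (x ℚ.* q ℚ.+ t)) (hᴸ-swap j x y zs) ⟩
  y ℚ.* hᴸ j (y ∷ x ∷ zs) ℚ.+ (x ℚ.* q ℚ.+ t) ∎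
  where
  open ≡-Reasoning
  u = hᴸ j (x ∷ y ∷ zs)
  p = hᴸ j (y ∷ zs)
  q = hᴸ j (x ∷ zs)
  t = hᴸ (suc j) zs

hᴸ-prep : ∀ {xs ys} → (∀ j → hᴸ j xs ≡ hᴸ j ys) → ∀ x j → hᴸ j (x ∷ xs) ≡ hᴸ j (x ∷ ys)
hᴸ-prep eq x zero    = refl
hᴸ-prep eq x (suc j) = cong₂ (λ u v → x ℚ.* u ℚ.+ v) (hᴸ-prep eq x j) (eq (suc j))

hᴸ-↭ : ∀ {xs ys} → xs ↭ ys → ∀ j → hᴸ j xs ≡ hᴸ j ys
hᴸ-↭ Perm.refl j = refl
hᴸ-↭ (prep x p) j = hᴸ-prep (hᴸ-↭ p) x j
hᴸ-↭ (swap {xs} x y p) j =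
  trans (hᴸ-swap j x y xs) (hᴸ-prep (hᴸ-prep (hᴸ-↭ p) x) y j)
hᴸ-↭ (Perm.trans p q) j = trans (hᴸ-↭ p j) (hᴸ-↭ q j)

-- The sum over weakly increasing sequences satisfies the recursion of `hᴸ`

sumOver : ∀ {A : Set} → (A → ℚ) → List A → ℚ
sumOver f []       = 0ℚ
sumOver f (x ∷ xs) = f x ℚ.+ sumOver f xs

seq-∑ : ∀ {A : Set} k (f : A → ℝ) xs → seq (∑ (map f xs)) k ≡ sumOver (λ x → seq (f x) k) xs
seq-∑ k f []       = refl
seq-∑ k f (x ∷ xs) = cong (seq (f x) k ℚ.+_) (seq-∑ k f xs)

sumOver-++ : ∀ {A : Set} (f : A → ℚ) xs ys → sumOver f (xs ++ ys) ≡ sumOver f xs ℚ.+ sumOver f ys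
sumOver-++ f []       ys = sym (ℚ.+-identityˡ _)
sumOver-++ f (x ∷ xs) ys =
  trans (cong (f x ℚ.+_) (sumOver-++ f xs ys)) (sym (ℚ.+-assoc (f x) _ _))

sumOver-cong : ∀ {A : Set} {f g : A → ℚ} → f ≗ g → sumOver f ≗ sumOver g
sumOver-cong f≗g []       = refl
sumOver-cong f≗g (x ∷ xs) = cong₂ ℚ._+_ (f≗g x) (sumOver-cong f≗g xs)

sumOver-tabulate : ∀ {A : Set} {n} (f : A → ℚ) (g : Fin n → A) →
  sumOver f (tabulate g) ≡ sumOver (f ∘ g) (allFin n)
sumOver-tabulate {n = zero}  f g = refl
sumOver-tabulate {n = suc n} f g = cong (f (g zero) ℚ.+_)
  (trans (sumOver-tabulate f (g ∘ suc)) (sym (sumOver-tabulate (f ∘ g) suc)))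

-- Groups the monomials of degree `j + 1` by their smallest index `i`: the other `j` factors have
-- indices from `i` on, hence the `drop`.
hᴸ-first : ∀ {n} (b : Fin n → ℚ) j →
  sumOver (λ i → b i ℚ.* hᴸ j (drop (toℕ i) (tabulate b))) (allFin n) ≡ hᴸ (suc j) (tabulate b)
hᴸ-first {zero}  b j = refl
hᴸ-first {suc n} b j = cong (b zero ℚ.* hᴸ j (tabulate b) ℚ.+_)
  (trans (sumOver-tabulate {n = n} _ suc) (hᴸ-first (b ∘ suc) j))

≤?-suc : ∀ {m n} (i : Fin m) (i′ : Fin n) → does (suc i Fin.≤? suc i′) ≡ does (i Fin.≤? i′)
≤?-suc zero    i′ = refl
≤?-suc (suc i) i′ = refl

-- The same grouping when smallest indices below `i` are excluded. The guard has the form in which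
-- the test for linkedness produces it in `consing`.
hᴸ-first≥ : ∀ {n} (b : Fin n → ℚ) j (i : Fin n) →
  sumOver (λ i′ → if does (i Fin.≤? i′) then b i′ ℚ.* hᴸ j (drop (toℕ i′) (tabulate b)) else 0ℚ) (allFin n)
    ≡ hᴸ (suc j) (drop (toℕ i) (tabulate b))
hᴸ-first≥ b j zero = hᴸ-first b j
hᴸ-first≥ {suc n} b j (suc i) =
  trans (ℚ.+-identityˡ _) (trans (sumOver-tabulate {n = n} _ suc)
    (trans (sumOver-cong (λ i′ → cong (λ le → if le then b (suc i′) ℚ.* _ else 0ℚ) (≤?-suc i i′)) (allFin n))
      (hᴸ-first≥ (b ∘ suc) j i)))

module _ {n} (a : Vector ℝ n) (k : ℕ) where

  private
    aₖ : Fin n → ℚ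
    aₖ i = seq (a i) k

    term : List (Fin n) → ℚ
    term w = seq (∏ (map a w)) k

    increasing : List (List (Fin n)) → List (List (Fin n))
    increasing = filter (linked? Fin._≤?_)

    -- The list `i ∷ i′ ∷ w` is linked exactly when `i ≤ i′` and `i′ ∷ w` is linked, so the first
    -- test is common to all `w` and the factor for `i` comes out.
    consing : ∀ i i′ ws → sumOver term (increasing (map (i ∷_) (map (i′ ∷_) ws)))
      ≡ aₖ i ℚ.* (if does (i Fin.≤? i′) then sumOver term (increasing (map (i′ ∷_) ws)) else 0ℚ)
    consing i i′ [] with does (i Fin.≤? i′)
    ... | true  = sym (ℚ.*-zeroʳ (aₖ i))
    ... | false = sym (ℚ.*-zeroʳ (aₖ i))
    consing i i′ (w ∷ ws) with does (i Fin.≤? i′) | does (linked? Fin._≤?_ (i′ ∷ w)) | consing i i′ ws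
    ... | true  | true  | ih = trans (cong (aₖ i ℚ.* term (i′ ∷ w) ℚ.+_) ih)
                                     (sym (ℚ.*-distribˡ-+ (aₖ i) (term (i′ ∷ w)) _))
    ... | true  | false | ih = ih
    ... | false | _     | ih = ih

    splitSecond : ∀ i is ws → sumOver term (increasing (map (i ∷_) (cartesianProductWith _∷_ is ws)))
      ≡ aₖ i ℚ.* sumOver (λ i′ → if does (i Fin.≤? i′)
                                 then sumOver term (increasing (map (i′ ∷_) ws)) else 0ℚ) is
    splitSecond i []        ws = sym (ℚ.*-zeroʳ (aₖ i))
    splitSecond i (i′ ∷ is) ws = begin
      sumOver term (increasing (map (i ∷_) (map (i′ ∷_) ws ++ rest)))
        ≡⟨ cong (sumOver term ∘ increasing) (map-++ (i ∷_) (map (i′ ∷_) ws) rest) ⟩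
      sumOver term (increasing (map (i ∷_) (map (i′ ∷_) ws) ++ map (i ∷_) rest))
        ≡⟨ cong (sumOver term) (filter-++ (linked? Fin._≤?_) (map (i ∷_) (map (i′ ∷_) ws)) (map (i ∷_) rest)) ⟩
      sumOver term (increasing (map (i ∷_) (map (i′ ∷_) ws)) ++ increasing (map (i ∷_) rest))
        ≡⟨ sumOver-++ term (increasing (map (i ∷_) (map (i′ ∷_) ws))) _ ⟩
      sumOver term (increasing (map (i ∷_) (map (i′ ∷_) ws))) ℚ.+ sumOver term (increasing (map (i ∷_) rest))
        ≡⟨ cong₂ ℚ._+_ (consing i i′ ws) (splitSecond i is ws) ⟩
      _ ≡⟨ ℚ.*-distribˡ-+ (aₖ i) _ _ ⟨
      _ ∎
      where
      open ≡-Reasoning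
      rest = cartesianProductWith _∷_ is ws

    -- Induction on `j`: the second index runs over all `i′ ≥ i`, and the sequences that start at
    -- `i′` are known from the previous length.
    startingAt : ∀ j (i : Fin n) → sumOver term (increasing (map (i ∷_) (sequences n j)))
      ≡ aₖ i ℚ.* hᴸ j (drop (toℕ i) (tabulate aₖ))
    startingAt zero    i = ℚ.+-identityʳ _
    startingAt (suc j) i = begin
      sumOver term (increasing (map (i ∷_) (cartesianProductWith _∷_ (allFin n) (sequences n j))))
        ≡⟨ splitSecond i (allFin n) (sequences n j) ⟩
      _ ≡⟨ cong (aₖ i ℚ.*_) (sumOver-cong (λ i′ → cong (λ u → if does (i Fin.≤? i′) then u else 0ℚ) (startingAt j i′))
             (allFin n)) ⟩
      _ ≡⟨ cong (aₖ i ℚ.*_) (hᴸ-first≥ aₖ j i) ⟩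
      aₖ i ℚ.* hᴸ (suc j) (drop (toℕ i) (tabulate aₖ)) ∎
      where open ≡-Reasoning

    splitFirst : ∀ is ws → sumOver term (increasing (cartesianProductWith _∷_ is ws))
      ≡ sumOver (λ i → sumOver term (increasing (map (i ∷_) ws))) is
    splitFirst []       ws = refl
    splitFirst (i ∷ is) ws = begin
      sumOver term (increasing (map (i ∷_) ws ++ rest))
        ≡⟨ cong (sumOver term) (filter-++ (linked? Fin._≤?_) (map (i ∷_) ws) rest) ⟩
      sumOver term (increasing (map (i ∷_) ws) ++ increasing rest)
        ≡⟨ sumOver-++ term (increasing (map (i ∷_) ws)) _ ⟩
      sumOver term (increasing (map (i ∷_) ws)) ℚ.+ sumOver term (increasing rest)
        ≡⟨ cong (sumOver term (increasing (map (i ∷_) ws)) ℚ.+_) (splitFirst is ws) ⟩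
      _ ∎
      where
      open ≡-Reasoning
      rest = cartesianProductWith _∷_ is ws

  -- An exact equality of rationals at every index `k`, since the arithmetic of `ℝ` acts termwise.
  -- It moves the whole argument to `hᴸ`.
  seq-h : ∀ j → seq (h j a) k ≡ hᴸ j (tabulate aₖ)
  seq-h zero    = refl
  seq-h (suc j) = begin
    seq (h (suc j) a) k
      ≡⟨ seq-∑ k (λ is → ∏ (map a is)) (weaklyIncreasing n (suc j)) ⟩
    sumOver term (increasing (cartesianProductWith _∷_ (allFin n) (sequences n j)))
      ≡⟨ splitFirst (allFin n) (sequences n j) ⟩
    _ ≡⟨ sumOver-cong (startingAt j) (allFin n) ⟩
    _ ≡⟨ hᴸ-first aₖ j ⟩
    hᴸ (suc j) (tabulate aₖ) ∎
    where open ≡-Reasoning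

-- Linear combinations of the `hᴸ` and knot insertion

dot : List ℚ → (ℕ → ℚ) → ℚ
dot []       u = 0ℚ
dot (c ∷ cs) u = c ℚ.* u 0 ℚ.+ dot cs (u ∘ suc)

-- `H⁻` pairs each coefficient with the degree one lower, so that it is the divided difference of
-- `Hᴸ` in its first two arguments.
Hᴸ H⁻ : List ℚ → List ℚ → ℚ
Hᴸ cs xs = dot cs (λ j → hᴸ j xs)
H⁻ cs xs = dot cs (λ j → h⁻ j xs)

dot-cong : ∀ cs {u v} → u ≗ v → dot cs u ≡ dot cs v
dot-cong []       u≗v = refl
dot-cong (c ∷ cs) u≗v = cong₂ ℚ._+_ (cong (c ℚ.*_) (u≗v 0)) (dot-cong cs (u≗v ∘ suc))

seq-dot : ∀ k {m} (c : Vector ℝ m) (f : ℕ → ℝ) →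
  seq (∑ (tabulate (λ j → c j * f (toℕ j)))) k ≡ dot (tabulate (λ j → seq (c j) k)) (λ j → seq (f j) k)
seq-dot k {zero}  c f = refl
seq-dot k {suc m} c f = cong (seq (c zero) k ℚ.* seq (f 0) k ℚ.+_) (seq-dot k (c ∘ suc) (f ∘ suc))

seq-H : ∀ k {n m} (c : Vector ℝ (suc m)) (a : Vector ℝ n) →
  seq (H c a) k ≡ Hᴸ (tabulate (λ j → seq (c j) k)) (tabulate (λ i → seq (a i) k))
seq-H k c a = trans (seq-dot k c (λ j → h j a)) (dot-cong (tabulate (λ j → seq (c j) k)) (seq-h a k))

Hᴸ-↭ : ∀ cs {xs ys} → xs ↭ ys → Hᴸ cs xs ≡ Hᴸ cs ys
Hᴸ-↭ cs p = dot-cong cs (hᴸ-↭ p)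

H⁻-↭ : ∀ cs {xs ys} → xs ↭ ys → H⁻ cs xs ≡ H⁻ cs ys
H⁻-↭ cs p = dot-cong cs λ where
  zero    → refl
  (suc j) → hᴸ-↭ p j

dot-diff : ∀ cs {u v w} t → (∀ j → u j ℚ.- v j ≡ t ℚ.* w j) → dot cs u ℚ.- dot cs v ≡ t ℚ.* dot cs w
dot-diff []       t eq = sym (ℚ.*-zeroʳ t)
dot-diff (c ∷ cs) {u} {v} {w} t eq = begin
  (c ℚ.* u 0 ℚ.+ U) ℚ.- (c ℚ.* v 0 ℚ.+ V)
    ≡⟨ solve 5 (λ c u U v V → (c :* u :+ U) :- (c :* v :+ V) := c :* (u :- v) :+ (U :- V))
         refl c (u 0) U (v 0) V ⟩
  c ℚ.* (u 0 ℚ.- v 0) ℚ.+ (U ℚ.- V)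
    ≡⟨ cong₂ (λ d e → c ℚ.* d ℚ.+ e) (eq 0) (dot-diff cs t (eq ∘ suc)) ⟩
  c ℚ.* (t ℚ.* w 0) ℚ.+ t ℚ.* W
    ≡⟨ solve 4 (λ c t w W → c :* (t :* w) :+ t :* W := t :* (c :* w :+ W)) refl c t (w 0) W ⟩
  t ℚ.* (c ℚ.* w 0 ℚ.+ W) ∎
  where
  open ≡-Reasoning
  U = dot cs (u ∘ suc)
  V = dot cs (v ∘ suc)
  W = dot cs (w ∘ suc)

Hᴸ-diff : ∀ cs x y zs → Hᴸ cs (x ∷ zs) ℚ.- Hᴸ cs (y ∷ zs) ≡ (x ℚ.- y) ℚ.* H⁻ cs (x ∷ y ∷ zs)
Hᴸ-diff cs x y zs = dot-diff cs (x ℚ.- y) (λ j → hᴸ-diff j x y zs)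

-- The last hypothesis says that c divides the segment from a to b in the ratio κ : 1.
knot-insertion : ∀ cs κ a b c zs → κ ℚ.* (b ℚ.- c) ℚ.+ (a ℚ.- c) ≡ 0ℚ →
  (κ ℚ.+ 1ℚ) ℚ.* Hᴸ cs (a ∷ b ∷ zs) ≡ κ ℚ.* Hᴸ cs (a ∷ c ∷ zs) ℚ.+ Hᴸ cs (c ∷ b ∷ zs)
knot-insertion cs κ a b c zs bal = begin
  (κ ℚ.+ 1ℚ) ℚ.* f
    -- By symmetry of `H⁻` both differences `f - p` and `f - q` are multiples of the same `g`, so
    -- the error term acquires the factor `κ (b - c) + (a - c)`.
    ≡⟨ solve 4 (λ κ f p q → (κ :+ con 1ℚ) :* f := κ :* p :+ q :+ (κ :* (f :- p) :+ (f :- q)))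
         refl κ f p q ⟩
  κ ℚ.* p ℚ.+ q ℚ.+ (κ ℚ.* (f ℚ.- p) ℚ.+ (f ℚ.- q))
    ≡⟨ cong₂ (λ d e → κ ℚ.* p ℚ.+ q ℚ.+ (κ ℚ.* d ℚ.+ e)) f-p (Hᴸ-diff cs a c (b ∷ zs)) ⟩
  κ ℚ.* p ℚ.+ q ℚ.+ (κ ℚ.* ((b ℚ.- c) ℚ.* g) ℚ.+ (a ℚ.- c) ℚ.* g)
    ≡⟨ solve 5 (λ s κ d e g → s :+ (κ :* (d :* g) :+ e :* g) := s :+ (κ :* d :+ e) :* g)
         refl (κ ℚ.* p ℚ.+ q) κ (b ℚ.- c) (a ℚ.- c) g ⟩
  κ ℚ.* p ℚ.+ q ℚ.+ (κ ℚ.* (b ℚ.- c) ℚ.+ (a ℚ.- c)) ℚ.* g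
    ≡⟨ cong (λ d → κ ℚ.* p ℚ.+ q ℚ.+ d ℚ.* g) bal ⟩
  κ ℚ.* p ℚ.+ q ℚ.+ 0ℚ ℚ.* g
    ≡⟨ solve 2 (λ s g → s :+ con 0ℚ :* g := s) refl (κ ℚ.* p ℚ.+ q) g ⟩
  κ ℚ.* p ℚ.+ q ∎
  where
  open ≡-Reasoning
  f = Hᴸ cs (a ∷ b ∷ zs)
  p = Hᴸ cs (a ∷ c ∷ zs)
  q = Hᴸ cs (c ∷ b ∷ zs)
  g = H⁻ cs (a ∷ c ∷ b ∷ zs)
  f-p : f ℚ.- p ≡ (b ℚ.- c) ℚ.* g
  f-p = begin
    f ℚ.- p
      ≡⟨ cong₂ ℚ._-_ (Hᴸ-↭ cs (swap a b Perm.refl)) (Hᴸ-↭ cs (swap a c Perm.refl)) ⟩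
    Hᴸ cs (b ∷ a ∷ zs) ℚ.- Hᴸ cs (c ∷ a ∷ zs)
      ≡⟨ Hᴸ-diff cs b c (a ∷ zs) ⟩
    (b ℚ.- c) ℚ.* H⁻ cs (b ∷ c ∷ a ∷ zs)
      ≡⟨ cong ((b ℚ.- c) ℚ.*_) (H⁻-↭ cs (↭-trans (swap b c Perm.refl)
           (↭-trans (prep c (swap b a Perm.refl)) (swap c a Perm.refl)))) ⟩
    (b ℚ.- c) ℚ.* g ∎

-- Bounds and Lipschitz estimates

*-monoʳ-≤ : ∀ r {p q} → 0ℚ ℚ.≤ r → p ℚ.≤ q → r ℚ.* p ℚ.≤ r ℚ.* q
*-monoʳ-≤ r 0≤r = ℚ.*-monoˡ-≤-nonNeg r {{ℚ.nonNegative 0≤r}}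

*-mono-≤ : ∀ {p q r s} → 0ℚ ℚ.≤ p → 0ℚ ℚ.≤ s → p ℚ.≤ q → r ℚ.≤ s → p ℚ.* r ℚ.≤ q ℚ.* s
*-mono-≤ {p} {q} {r} {s} 0≤p 0≤s p≤q r≤s = ℚ.≤-trans (*-monoʳ-≤ p 0≤p r≤s)
  (ℚ.*-monoʳ-≤-nonNeg s {{ℚ.nonNegative 0≤s}} p≤q)

*-nonNeg : ∀ {p q} → 0ℚ ℚ.≤ p → 0ℚ ℚ.≤ q → 0ℚ ℚ.≤ p ℚ.* q
*-nonNeg {p} {q} 0≤p 0≤q = subst (ℚ._≤ p ℚ.* q) (ℚ.*-zeroʳ p) (*-monoʳ-≤ p 0≤p 0≤q)

∣x*y∣≤ : ∀ {x y X Y} → ∣ x ∣ ℚ.≤ X → ∣ y ∣ ℚ.≤ Y → ∣ x ℚ.* y ∣ ℚ.≤ X ℚ.* Y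
∣x*y∣≤ {x} {y} {X} {Y} x≤ y≤ = subst (ℚ._≤ X ℚ.* Y) (sym (ℚ.∣p*q∣≡∣p∣*∣q∣ x y))
  (*-mono-≤ (ℚ.0≤∣p∣ x) (ℚ.≤-trans (ℚ.0≤∣p∣ y) y≤) x≤ y≤)

∣x+y∣≤ : ∀ {x y X Y} → ∣ x ∣ ℚ.≤ X → ∣ y ∣ ℚ.≤ Y → ∣ x ℚ.+ y ∣ ℚ.≤ X ℚ.+ Y
∣x+y∣≤ {x} {y} x≤ y≤ = ℚ.≤-trans (ℚ.∣p+q∣≤∣p∣+∣q∣ x y) (ℚ.+-mono-≤ x≤ y≤)

∣x-y∣≤ : ∀ {x y X Y} → ∣ x ∣ ℚ.≤ X → ∣ y ∣ ℚ.≤ Y → ∣ x ℚ.- y ∣ ℚ.≤ X ℚ.+ Y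
∣x-y∣≤ {y = y} {Y = Y} x≤ y≤ = ∣x+y∣≤ x≤ (subst (ℚ._≤ Y) (sym (ℚ.∣-p∣≡∣p∣ y)) y≤)

Bounded : ℚ → List ℚ → Set
Bounded B = All (λ x → ∣ x ∣ ℚ.≤ B)

-- All coefficients of `hᴸ` are nonnegative, so the triangle inequality bounds it by its own value
-- at `B`.
hᴸ-bound : ∀ {B} j xs → Bounded B xs → ∣ hᴸ j xs ∣ ℚ.≤ hᴸ j (List.replicate (length xs) B)
hᴸ-bound zero    xs       bs       = ℚ.≤-refl
hᴸ-bound (suc j) []       bs       = ℚ.≤-refl
hᴸ-bound (suc j) (x ∷ xs) (b ∷ bs) =
  ∣x+y∣≤ (∣x*y∣≤ b (hᴸ-bound j (x ∷ xs) (b ∷ bs))) (hᴸ-bound (suc j) xs bs)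

dot-bound : ∀ {C} cs {u v} → Bounded C cs → (∀ j → ∣ u j ∣ ℚ.≤ v j) →
  ∣ dot cs u ∣ ℚ.≤ dot (List.replicate (length cs) C) v
dot-bound []       bs       u≤v = ℚ.≤-refl
dot-bound (c ∷ cs) (b ∷ bs) u≤v = ∣x+y∣≤ (∣x*y∣≤ b (u≤v 0)) (dot-bound cs bs (u≤v ∘ suc))

-- A Lipschitz constant, in each variable, of H in n variables with m coefficients.
lip : ℕ → ℚ → ℕ → ℚ → ℚ
lip m C n B = H⁻ (List.replicate m C) (List.replicate (suc n) B)

H⁻-bound : ∀ {B C} cs xs → Bounded C cs → Bounded B xs →
  ∣ H⁻ cs xs ∣ ℚ.≤ H⁻ (List.replicate (length cs) C) (List.replicate (length xs) B)
H⁻-bound cs xs bc bx = dot-bound cs bc λ where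
  zero    → ℚ.≤-refl
  (suc j) → hᴸ-bound j xs bx

lip-nonNeg : ∀ m {C} n {B} → 0ℚ ℚ.≤ C → 0ℚ ℚ.≤ B → 0ℚ ℚ.≤ lip m C n B
lip-nonNeg m {C} n {B} 0≤C 0≤B = dot-nonNeg m λ where
    zero    → ℚ.≤-refl
    (suc j) → hᴸ-nonNeg j (suc n)
  where
  +-nonNeg : ∀ {p q} → 0ℚ ℚ.≤ p → 0ℚ ℚ.≤ q → 0ℚ ℚ.≤ p ℚ.+ q
  +-nonNeg = ℚ.+-mono-≤
  hᴸ-nonNeg : ∀ j l → 0ℚ ℚ.≤ hᴸ j (List.replicate l B)
  hᴸ-nonNeg zero    l       = ℚ.<⇒≤ 0<1
  hᴸ-nonNeg (suc j) zero    = ℚ.≤-refl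
  hᴸ-nonNeg (suc j) (suc l) = +-nonNeg (*-nonNeg 0≤B (hᴸ-nonNeg j (suc l))) (hᴸ-nonNeg (suc j) l)
  dot-nonNeg : ∀ m {u} → (∀ j → 0ℚ ℚ.≤ u j) → 0ℚ ℚ.≤ dot (List.replicate m C) u
  dot-nonNeg zero    0≤u = ℚ.≤-refl
  dot-nonNeg (suc m) 0≤u = +-nonNeg (*-nonNeg 0≤C (0≤u 0)) (dot-nonNeg m (0≤u ∘ suc))

Hᴸ-lipschitz : ∀ {B C δ} cs x y zs → Bounded C cs → Bounded B (x ∷ y ∷ zs) → ∣ x ℚ.- y ∣ ℚ.≤ δ →
  ∣ Hᴸ cs (x ∷ zs) ℚ.- Hᴸ cs (y ∷ zs) ∣ ℚ.≤ δ ℚ.* lip (length cs) C (suc (length zs)) B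
Hᴸ-lipschitz cs x y zs bc bx close = subst (λ d → ∣ d ∣ ℚ.≤ _) (sym (Hᴸ-diff cs x y zs))
  (∣x*y∣≤ close (H⁻-bound cs (x ∷ y ∷ zs) bc bx))

-- Defined by repeated addition so that `ι (suc k)` computes to `1ℚ + ι k`, the form used with the
-- ring solver.
ι : ℕ → ℚ
ι zero    = 0ℚ
ι (suc k) = 1ℚ ℚ.+ ι k

replicate-shift : ∀ u (y : ℚ) zs → List.replicate u y ++ y ∷ zs ≡ y ∷ List.replicate u y ++ zs
replicate-shift zero    y zs = refl
replicate-shift (suc u) y zs = cong (y ∷_) (replicate-shift u y zs)

-- The entries of `ws` are replaced by `y` one at a time, each at the cost of one Lipschitz
-- estimate. A replaced entry joins `zs`, which keeps the number `n` of variables, and with it the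
-- constant, fixed.
Hᴸ-drift : ∀ {B C δ} n cs ws y zs → length ws ℕ.+ length zs ≡ n →
  Bounded C cs → Bounded B ws → ∣ y ∣ ℚ.≤ B → Bounded B zs → All (λ w → ∣ w ℚ.- y ∣ ℚ.≤ δ) ws →
  ∣ Hᴸ cs (ws ++ zs) ℚ.- Hᴸ cs (List.replicate (length ws) y ++ zs) ∣
    ℚ.≤ ι (length ws) ℚ.* (δ ℚ.* lip (length cs) C n B)
Hᴸ-drift {B} {C} {δ} n cs [] y zs len bc bw by bz close = ℚ.≤-reflexive
  (trans (cong ∣_∣ (ℚ.+-inverseʳ (Hᴸ cs zs))) (sym (ℚ.*-zeroˡ (δ ℚ.* lip (length cs) C n B))))
Hᴸ-drift {B} {C} {δ} n cs (w ∷ ws) y zs len bc (bw ∷ bws) by bz (wy ∷ close) = begin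
  ∣ Hᴸ cs (w ∷ ws ++ zs) ℚ.- Hᴸ cs (y ∷ List.replicate (length ws) y ++ zs) ∣
    ≡⟨ cong ∣_∣ (solve 3 (λ a b c → a :- c := (a :- b) :+ (b :- c)) refl
         (Hᴸ cs (w ∷ ws ++ zs)) (Hᴸ cs (y ∷ ws ++ zs)) (Hᴸ cs (y ∷ List.replicate (length ws) y ++ zs))) ⟩
  ∣ (Hᴸ cs (w ∷ ws ++ zs) ℚ.- Hᴸ cs (y ∷ ws ++ zs))
      ℚ.+ (Hᴸ cs (y ∷ ws ++ zs) ℚ.- Hᴸ cs (y ∷ List.replicate (length ws) y ++ zs)) ∣
    ≤⟨ ∣x+y∣≤ head rest ⟩
  δ ℚ.* lip (length cs) C n B ℚ.+ ι (length ws) ℚ.* (δ ℚ.* lip (length cs) C n B)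
    ≡⟨ solve 2 (λ k d → d :+ k :* d := (con 1ℚ :+ k) :* d) refl (ι (length ws)) (δ ℚ.* lip (length cs) C n B) ⟩
  ι (suc (length ws)) ℚ.* (δ ℚ.* lip (length cs) C n B) ∎
  where
  open ℚ.≤-Reasoning
  head : ∣ Hᴸ cs (w ∷ ws ++ zs) ℚ.- Hᴸ cs (y ∷ ws ++ zs) ∣ ℚ.≤ δ ℚ.* lip (length cs) C n B
  head = subst (λ l → _ ℚ.≤ δ ℚ.* lip (length cs) C l B) (trans (cong suc (length-++ ws)) len)
    (Hᴸ-lipschitz cs w y (ws ++ zs) bc (bw ∷ by ∷ All.++⁺ bws bz) wy)
  rest : ∣ Hᴸ cs (y ∷ ws ++ zs) ℚ.- Hᴸ cs (y ∷ List.replicate (length ws) y ++ zs) ∣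
    ℚ.≤ ι (length ws) ℚ.* (δ ℚ.* lip (length cs) C n B)
  rest = subst₂ (λ u v → ∣ u ℚ.- v ∣ ℚ.≤ _)
    (Hᴸ-↭ cs (shift y ws zs)) (cong (Hᴸ cs) (replicate-shift (length ws) y zs))
    (Hᴸ-drift n cs ws y (y ∷ zs) (trans (ℕ.+-suc (length ws) (length zs)) len) bc bws by (by ∷ bz) close)

lower : ∀ {u v e q} → ∣ u ℚ.- v ∣ ℚ.≤ e → q ℚ.≤ v → q ℚ.- e ℚ.≤ u
lower {u} {v} {e} {q} close q≤v = begin
  q ℚ.- e          ≤⟨ ℚ.+-mono-≤ q≤v (ℚ.neg-antimono-≤ close) ⟩
  v ℚ.- ∣ u ℚ.- v ∣ ≤⟨ ℚ.+-monoʳ-≤ v (ℚ.neg-antimono-≤ (subst (v ℚ.- u ℚ.≤_) (∣p-q∣≡∣q-p∣ v u) (p≤∣p∣ (v ℚ.- u)))) ⟩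
  v ℚ.- (v ℚ.- u)  ≡⟨ solve 2 (λ u v → v :- (v :- u) := u) refl u v ⟩
  u                ∎
  where open ℚ.≤-Reasoning

-- Knot insertion divided by `κ + 1` is a convex combination, and a common lower bound passes to it.
knot-insertion-≥ : ∀ cs κ a b c zs {q} → 0ℚ ℚ.≤ κ → κ ℚ.* (b ℚ.- c) ℚ.+ (a ℚ.- c) ≡ 0ℚ →
  q ℚ.≤ Hᴸ cs (a ∷ c ∷ zs) → q ℚ.≤ Hᴸ cs (c ∷ b ∷ zs) → q ℚ.≤ Hᴸ cs (a ∷ b ∷ zs)
knot-insertion-≥ cs κ a b c zs {q} 0≤κ bal ac cb = ℚ.*-cancelˡ-≤-pos (κ ℚ.+ 1ℚ) {{ℚ.positive (ℚ.+-mono-≤-< 0≤κ 0<1)}}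
  (begin
    (κ ℚ.+ 1ℚ) ℚ.* q
      ≡⟨ solve 2 (λ κ q → (κ :+ con 1ℚ) :* q := κ :* q :+ q) refl κ q ⟩
    κ ℚ.* q ℚ.+ q
      ≤⟨ ℚ.+-mono-≤ (*-monoʳ-≤ κ 0≤κ ac) cb ⟩
    κ ℚ.* Hᴸ cs (a ∷ c ∷ zs) ℚ.+ Hᴸ cs (c ∷ b ∷ zs)
      ≡⟨ knot-insertion cs κ a b c zs bal ⟨
    (κ ℚ.+ 1ℚ) ℚ.* Hᴸ cs (a ∷ b ∷ zs) ∎)
  where open ℚ.≤-Reasoning

-- Inserting c between a and each copy of b in turn changes all b into c.
advance : ∀ cs κ a b c zs p {q} → 0ℚ ℚ.≤ κ → κ ℚ.* (b ℚ.- c) ℚ.+ (a ℚ.- c) ≡ 0ℚ →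
  (∀ u v → u ℕ.+ v ≡ suc p → q ℚ.≤ Hᴸ cs (List.replicate u c ++ List.replicate v b ++ zs)) →
  q ℚ.≤ Hᴸ cs (a ∷ List.replicate p c ++ zs) → q ℚ.≤ Hᴸ cs (a ∷ List.replicate p b ++ zs)
advance cs κ a b c zs p {q} 0≤κ bal near start = go p 0 (ℕ.+-identityʳ p)
  where
  go : ∀ v u → v ℕ.+ u ≡ p → q ℚ.≤ Hᴸ cs (a ∷ List.replicate v b ++ List.replicate u c ++ zs)
  go zero    u refl = start
  -- Of the two values to be bounded, the first has one `b` fewer and one `c` more; the second has
  -- lost `a`, so that beside `zs` it contains only copies of `b` and `c`.
  go (suc v) u eq   = knot-insertion-≥ cs κ a b c (List.replicate v b ++ List.replicate u c ++ zs) 0≤κ bal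
    (subst (q ℚ.≤_) (Hᴸ-↭ cs (prep a (shift c (List.replicate v b) (List.replicate u c ++ zs))))
      (go v (suc u) (trans (ℕ.+-suc v u) eq)))
    (subst (q ℚ.≤_) (Hᴸ-↭ cs (prep c (shifts (List.replicate u c) (List.replicate (suc v) b))))
      (near (suc u) (suc v) (cong suc (trans (ℕ.+-comm u (suc v)) eq))))

-- Estimates for Cauchy sequences

ι-≃ : ∀ k → ℚ.toℚᵘ (ι k) ℚᵘ.≃ mkℚᵘ (ℤ.+ k) 0
ι-≃ zero    = ℚᵘ.≃-refl
ι-≃ (suc k) = begin-equality
  ℚ.toℚᵘ (1ℚ ℚ.+ ι k)       ≃⟨ ℚ.toℚᵘ-homo-+ 1ℚ (ι k) ⟩
  ℚᵘ.1ℚᵘ ℚᵘ.+ ℚ.toℚᵘ (ι k)  ≃⟨ ℚᵘ.+-congʳ ℚᵘ.1ℚᵘ (ι-≃ k) ⟩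
  ℚᵘ.1ℚᵘ ℚᵘ.+ mkℚᵘ (ℤ.+ k) 0
    ≃⟨ *≡* (cong (λ i → (ℤ.+ 1 ℤ.+ i) ℤ.* ℤ.+ 1) (ℤ.*-identityʳ (ℤ.+ k))) ⟩
  mkℚᵘ (ℤ.+ suc k) 0        ∎
  where open ℚᵘ.≤-Reasoning

-- The Archimedean property: the denominator is at least 1, so the absolute value of the numerator
-- serves as `N`.
ι-unbounded : ∀ q → ∃[ N ] q ℚ.≤ ι N
ι-unbounded q@(ℚ.mkℚ i d _) = N , ℚ.toℚᵘ-cancel-≤ (begin
  ℚ.toℚᵘ q          ≤⟨ *≤* (i≤∣i∣*d i) ⟩
  mkℚᵘ (ℤ.+ N) 0    ≃⟨ ι-≃ N ⟨
  ℚ.toℚᵘ (ι N)      ∎)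
  where
  open ℚᵘ.≤-Reasoning
  N = ℤ.∣ i ∣
  i≤∣i∣*d : ∀ i → i ℤ.* ℤ.+ 1 ℤ.≤ ℤ.+ ℤ.∣ i ∣ ℤ.* ℤ.+ suc d
  i≤∣i∣*d (ℤ.+ m) = ℤ.*-monoˡ-≤-nonNeg (ℤ.+ m) (ℤ.+≤+ (ℕ.s≤s ℕ.z≤n))
  i≤∣i∣*d ℤ.-[1+ m ] = ℤ.≤-trans (ℤ.≤-reflexive (ℤ.*-identityʳ ℤ.-[1+ m ])) ℤ.-≤+

ι-nonNeg : ∀ k → 0ℚ ℚ.≤ ι k
ι-nonNeg zero    = ℚ.≤-refl
ι-nonNeg (suc k) = ℚ.+-mono-≤ (ℚ.<⇒≤ 0<1) (ι-nonNeg k)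

ι-suc-pos : ∀ k → 0ℚ ℚ.< ι (suc k)
ι-suc-pos k = ℚ.+-mono-<-≤ 0<1 (ι-nonNeg k)

ι-mono : ∀ {j k} → j ℕ.≤ k → ι j ℚ.≤ ι k
ι-mono {k = k} ℕ.z≤n = ι-nonNeg k
ι-mono (ℕ.s≤s j≤k)   = ℚ.+-monoʳ-≤ 1ℚ (ι-mono j≤k)

-- Chooses a subdivision of a segment into `N + 1` parts: `t` is the relative step length, and an
-- error proportional to it is made at most `ε`.
mesh : ∀ {D ε} → 0ℚ ℚ.≤ D → 0ℚ ℚ.< ε →
  ∃[ N ] ∃[ t ] (0ℚ ℚ.< t × ι (suc N) ℚ.* t ≡ 1ℚ × t ℚ.* D ℚ.≤ ε)
mesh {D} {ε} 0≤D 0<ε =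
  -- `D` may be 0, whereas `divide` takes a positive dividend; hence `D + 1`.
  let δ , 0<δ , εδ≡ = divide ε (D ℚ.+ 1ℚ) 0<ε (ℚ.+-mono-≤-< 0≤D 0<1)
      N , δ≤N       = ι-unbounded δ
      t , 0<t , Nt≡ = divide (ι (suc N)) 1ℚ (ι-suc-pos N) 0<1
      open ℚ.≤-Reasoning
  in N , t , 0<t , Nt≡ , (begin
    t ℚ.* D
      ≤⟨ *-monoʳ-≤ t (ℚ.<⇒≤ 0<t) (begin
           D                     ≡⟨ ℚ.+-identityʳ D ⟨
           D ℚ.+ 0ℚ              ≤⟨ ℚ.+-monoʳ-≤ D (ℚ.<⇒≤ 0<1) ⟩
           D ℚ.+ 1ℚ              ≡⟨ εδ≡ ⟨
           ε ℚ.* δ               ≤⟨ *-monoʳ-≤ ε (ℚ.<⇒≤ 0<ε) (ℚ.≤-trans δ≤N (ι-mono (ℕ.n≤1+n N))) ⟩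
           ε ℚ.* ι (suc N)       ∎) ⟩
    t ℚ.* (ε ℚ.* ι (suc N))
      ≡⟨ solve 3 (λ t e n → t :* (e :* n) := e :* (n :* t)) refl t ε (ι (suc N)) ⟩
    ε ℚ.* (ι (suc N) ℚ.* t)
      ≡⟨ cong (ε ℚ.*_) Nt≡ ⟩
    ε ℚ.* 1ℚ
      ≡⟨ ℚ.*-identityʳ ε ⟩
    ε ∎)

min-pos : ∀ {p q} → 0ℚ ℚ.< p → 0ℚ ℚ.< q → ∃[ e ] (0ℚ ℚ.< e × e ℚ.≤ p × e ℚ.≤ q)
min-pos {p} {q} 0<p 0<q with ℚ.≤-total p q
... | inj₁ p≤q = p , 0<p , ℚ.≤-refl , p≤q
... | inj₂ q≤p = q , 0<q , q≤p , ℚ.≤-refl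

-- Eventual statements and signs of sequences

Eventually : (ℕ → Set) → Set
Eventually P = ∃[ N ] (∀ k → N ℕ.≤ k → P k)

always : ∀ {P : ℕ → Set} → (∀ k → P k) → Eventually P
always p = 0 , λ k _ → p k

infixl 4 _⊛_

_⊛_ : ∀ {P Q : ℕ → Set} → Eventually (λ k → P k → Q k) → Eventually P → Eventually Q
(M , f) ⊛ (N , p) = M ℕ.⊔ N , λ k K≤k →
  f k (ℕ.m⊔n≤o⇒m≤o M N K≤k) (p k (ℕ.m⊔n≤o⇒n≤o M N K≤k))

-- For a Cauchy sequence these say that the real number it represents is nonnegative and positive,
-- respectively.
NonNeg Pos : (ℕ → ℚ) → Set
NonNeg u = ∀ ε → 0ℚ ℚ.< ε → Eventually (λ k → ℚ.- ε ℚ.≤ u k)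
Pos u    = ∃[ ε ] (0ℚ ℚ.< ε × Eventually (λ k → ε ℚ.≤ u k))

Pos-resp : ∀ {u v} → u ≗ v → Pos u → Pos v
Pos-resp eq (ε , 0<ε , N , p) = ε , 0<ε , N , λ k N≤k → subst (ε ℚ.≤_) (eq k) (p k N≤k)

Pos⇒NonNeg : ∀ {u} → Pos u → NonNeg u
Pos⇒NonNeg (e , 0<e , N , p) ε 0<ε = N , λ k N≤k →
  ℚ.≤-trans (ℚ.neg-antimono-≤ (ℚ.<⇒≤ 0<ε)) (ℚ.≤-trans (ℚ.<⇒≤ 0<e) (p k N≤k))

<-intro : ∀ x y ε → 0ℚ ℚ.< ε → Eventually (λ k → seq x k ℚ.+ ε ℚ.≤ seq y k) → x < y
<-intro x y ε 0<ε (N , p) = ½ ℚ.* ε , half-pos 0<ε , N , λ k N≤k →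
  ℚ.<-≤-trans (ℚ.+-monoʳ-< (seq x k) ½ε<ε) (p k N≤k)
  where
  ½ε<ε : ½ ℚ.* ε ℚ.< ε
  ½ε<ε = subst₂ ℚ._<_ (ℚ.+-identityʳ _) (half+half ε) (ℚ.+-monoʳ-< (½ ℚ.* ε) (half-pos 0<ε))

<-elim : ∀ x y → x < y → ∃[ ε ] (0ℚ ℚ.< ε × Eventually (λ k → seq x k ℚ.+ ε ℚ.≤ seq y k))
<-elim x y (ε , 0<ε , N , p) = ε , 0<ε , N , λ k N≤k → ℚ.<⇒≤ (p k N≤k)

0<⇒Pos : ∀ z → 0ℝ < z → Pos (seq z)
0<⇒Pos z 0<z = let ε , 0<ε , N , p = <-elim 0ℝ z 0<z in
  ε , 0<ε , N , λ k N≤k → subst (ℚ._≤ seq z k) (ℚ.+-identityˡ ε) (p k N≤k)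

Pos⇒0< : ∀ z → Pos (seq z) → 0ℝ < z
Pos⇒0< z (ε , 0<ε , N , p) = <-intro 0ℝ z ε 0<ε
  (N , λ k N≤k → subst (ℚ._≤ seq z k) (sym (ℚ.+-identityˡ ε)) (p k N≤k))

const : ℚ → ℝ
const q = mkℝ (λ _ → q) (const-cauchy q)

-- Whether `y` is apart from 0 is undecidable, but a comparison of rationals at one index `n` beyond
-- all moduli is decidable: there `y` is at most `-η/2` or `y + η` is at least `η/2`, and `gap⇒<`
-- turns either gap into apartness.
#0-or-shift#0 : ∀ y {η} → 0ℚ ℚ.< η → y # 0ℝ ⊎ (y + const η) # 0ℝ
#0-or-shift#0 y {η} 0<η = go (½ ℚ.* η ℚ.≤? 0ℚ ℚ.- seq y n)
  where
  z = y + const η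
  ε = ½ ℚ.* η
  0<ε = half-pos 0<η
  δ = ½ ℚ.* (½ ℚ.* ε)
  0<δ = half-pos (half-pos 0<ε)
  L = proj₁ (cauchy y δ 0<δ)
  M = proj₁ (cauchy z δ 0<δ)
  N = proj₁ (cauchy 0ℝ δ 0<δ)
  n = L ℕ.⊔ M ℕ.⊔ N
  open ℚ.≤-Reasoning
  go : _ → _
  go (yes gap) = inj₁ (inj₁ (gap⇒< y 0ℝ ε 0<ε n
    (ℕ.≤-trans (ℕ.m≤m⊔n L M) (ℕ.m≤m⊔n (L ℕ.⊔ M) N)) (ℕ.m≤n⊔m (L ℕ.⊔ M) N) gap))
  go (no ¬gap) = inj₂ (inj₂ (gap⇒< 0ℝ z ε 0<ε n
    (ℕ.m≤n⊔m (L ℕ.⊔ M) N) (ℕ.≤-trans (ℕ.m≤n⊔m L M) (ℕ.m≤m⊔n (L ℕ.⊔ M) N)) (begin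
      ε
        ≡⟨ solve 1 (λ e → con ½ :* e := :- (con ½ :* e) :+ e) refl η ⟩
      ℚ.- ε ℚ.+ η
        ≤⟨ ℚ.+-monoˡ-≤ η (ℚ.neg-antimono-≤ (ℚ.<⇒≤ (ℚ.≰⇒> ¬gap))) ⟩
      ℚ.- (0ℚ ℚ.- seq y n) ℚ.+ η
        ≡⟨ solve 2 (λ y e → :- (con 0ℚ :- y) :+ e := (y :+ e) :- con 0ℚ) refl (seq y n) η ⟩
      (seq y n ℚ.+ η) ℚ.- 0ℚ ∎)))

-- Interpolation inside an open interval

lerpℚ : ℚ → ℚ → ℚ → ℚ
lerpℚ q a x = a ℚ.+ q ℚ.* (x ℚ.+ (ℚ.- 1ℚ) ℚ.* a)

-- Built from `+` and `*` in the same way as `lerpℚ`, so that its terms are `lerpℚ` of the terms by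
-- computation.
lerp : ℚ → ℝ → ℝ → ℝ
lerp q a x = a + const q * (x + const (ℚ.- 1ℚ) * a)

lerpℚ-mono : ∀ {q a a′ x x′} → 0ℚ ℚ.≤ q → q ℚ.≤ 1ℚ → a ℚ.≤ a′ → x ℚ.≤ x′ → lerpℚ q a x ℚ.≤ lerpℚ q a′ x′
lerpℚ-mono {q} {a} {a′} {x} {x′} 0≤q q≤1 a≤ x≤ = begin
  lerpℚ q a x                          ≡⟨ expand a x ⟩
  (1ℚ ℚ.- q) ℚ.* a ℚ.+ q ℚ.* x         ≤⟨ ℚ.+-mono-≤ (*-monoʳ-≤ (1ℚ ℚ.- q) 0≤1-q a≤) (*-monoʳ-≤ q 0≤q x≤) ⟩
  (1ℚ ℚ.- q) ℚ.* a′ ℚ.+ q ℚ.* x′       ≡⟨ expand a′ x′ ⟨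
  lerpℚ q a′ x′                        ∎
  where
  open ℚ.≤-Reasoning
  expand : ∀ a x → lerpℚ q a x ≡ (1ℚ ℚ.- q) ℚ.* a ℚ.+ q ℚ.* x
  expand = solve 3 (λ q a x → a :+ q :* (x :+ con (ℚ.- 1ℚ) :* a) := (con 1ℚ :- q) :* a :+ q :* x) refl q
  0≤1-q : 0ℚ ℚ.≤ 1ℚ ℚ.- q
  0≤1-q = subst (ℚ._≤ 1ℚ ℚ.- q) (ℚ.+-inverseʳ q) (ℚ.+-monoˡ-≤ (ℚ.- q) q≤1)

lerpℚ-diag : ∀ q a → lerpℚ q a a ≡ a
lerpℚ-diag = solve 2 (λ q a → a :+ q :* (a :+ con (ℚ.- 1ℚ) :* a) := a) refl

∣lerpℚ∣≤ : ∀ {q a x B} → 0ℚ ℚ.≤ q → q ℚ.≤ 1ℚ → ∣ a ∣ ℚ.≤ B → ∣ x ∣ ℚ.≤ B → ∣ lerpℚ q a x ∣ ℚ.≤ B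
∣lerpℚ∣≤ {q} {a} {x} {B} 0≤q q≤1 a≤B x≤B with ℚ.∣p∣≡p∨∣p∣≡-p (lerpℚ q a x)
... | inj₁ eq = subst (ℚ._≤ B) (sym eq)
  (subst (lerpℚ q a x ℚ.≤_) (lerpℚ-diag q B)
    (lerpℚ-mono 0≤q q≤1 (ℚ.≤-trans (p≤∣p∣ a) a≤B) (ℚ.≤-trans (p≤∣p∣ x) x≤B)))
... | inj₂ eq = subst (ℚ._≤ B) (sym eq)
  (subst₂ ℚ._≤_
    (solve 3 (λ q a x → :- a :+ q :* (:- x :+ con (ℚ.- 1ℚ) :* :- a) := :- (a :+ q :* (x :+ con (ℚ.- 1ℚ) :* a)))
      refl q a x)
    (lerpℚ-diag q B)
    (lerpℚ-mono 0≤q q≤1 (-p≤ a a≤B) (-p≤ x x≤B)))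
  where
  -p≤ : ∀ p → ∣ p ∣ ℚ.≤ B → ℚ.- p ℚ.≤ B
  -p≤ p p≤B = ℚ.≤-trans (p≤∣p∣ (ℚ.- p)) (subst (ℚ._≤ B) (sym (ℚ.∣-p∣≡∣p∣ p)) p≤B)

-- With `m` the smaller of the two gaps, `r + m` eventually lies below both end points, hence below
-- their interpolation, because interpolation is monotone and fixes `r + m`.
lerp-above : ∀ r a x {q} → 0ℚ ℚ.≤ q → q ℚ.≤ 1ℚ → r < a → r < x → r < lerp q a x
lerp-above r a x {q} 0≤q q≤1 r<a r<x =
  let d , 0<d , evd         = <-elim r a r<a
      e , 0<e , eve         = <-elim r x r<x
      m , 0<m , m≤d , m≤e   = min-pos 0<d 0<e
  in <-intro r (lerp q a x) m 0<m (always (λ k p p′ →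
       subst (ℚ._≤ lerpℚ q (seq a k) (seq x k)) (lerpℚ-diag q (seq r k ℚ.+ m))
         (lerpℚ-mono 0≤q q≤1 (ℚ.≤-trans (ℚ.+-monoʳ-≤ (seq r k) m≤d) p)
                             (ℚ.≤-trans (ℚ.+-monoʳ-≤ (seq r k) m≤e) p′)))
       ⊛ evd ⊛ eve)

lerp-below : ∀ s a x {q} → 0ℚ ℚ.≤ q → q ℚ.≤ 1ℚ → a < s → x < s → lerp q a x < s
lerp-below s a x {q} 0≤q q≤1 a<s x<s =
  let d , 0<d , evd         = <-elim a s a<s
      e , 0<e , eve         = <-elim x s x<s
      m , 0<m , m≤d , m≤e   = min-pos 0<d 0<e
  in <-intro (lerp q a x) s m 0<m (always (λ k p p′ →
       subst₂ ℚ._≤_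
         (solve 4 (λ q a x m → (a :+ m) :+ q :* ((x :+ m) :+ con (ℚ.- 1ℚ) :* (a :+ m))
                            := (a :+ q :* (x :+ con (ℚ.- 1ℚ) :* a)) :+ m) refl q (seq a k) (seq x k) m)
         (lerpℚ-diag q (seq s k))
         (lerpℚ-mono 0≤q q≤1 (ℚ.≤-trans (ℚ.+-monoʳ-≤ (seq a k) m≤d) p)
                             (ℚ.≤-trans (ℚ.+-monoʳ-≤ (seq x k) m≤e) p′)))
       ⊛ evd ⊛ eve)

lerp-∈ : ∀ r s a x {q} → 0ℚ ℚ.≤ q → q ℚ.≤ 1ℚ → a ∈⟨ r , s ⟩ → x ∈⟨ r , s ⟩ → lerp q a x ∈⟨ r , s ⟩
lerp-∈ r s a x {q} 0≤q q≤1 (r<a , a<s) (r<x , x<s) = left r<a r<x , right a<s x<s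
  where
  left : ∀ {r} → r <± [ a ] → r <± [ x ] → r <± [ lerp q a x ]
  left ⊥±<[ _ ] ⊥±<[ _ ] = ⊥±<[ _ ]
  left {[ r ]} ⟦ p ⟧ ⟦ p′ ⟧ = ⟦ lerp-above r a x 0≤q q≤1 p p′ ⟧
  right : ∀ {s} → [ a ] <± s → [ x ] <± s → [ lerp q a x ] <± s
  right [ _ ]<⊤± [ _ ]<⊤± = [ _ ]<⊤±
  right {[ s ]} ⟦ p ⟧ ⟦ p′ ⟧ = ⟦ lerp-below s a x 0≤q q≤1 p p′ ⟧

-- Makes room for the shift in `diagonal-nonNeg`: a move to the right preserves the left bound, and
-- spending half of the gap to `s` leaves the other half.
∈-open : ∀ r s y → y ∈⟨ r , s ⟩ →
  ∃[ ε ] (0ℚ ℚ.< ε × (∀ η → 0ℚ ℚ.< η → η ℚ.≤ ε → (y + const η) ∈⟨ r , s ⟩))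
∈-open r s y (r<y , y<s) = let ε , 0<ε , up = right y<s in
  ε , 0<ε , λ η 0<η η≤ε → left η 0<η r<y , up η η≤ε
  where
  left : ∀ {r} η → 0ℚ ℚ.< η → r <± [ y ] → r <± [ y + const η ]
  left η 0<η ⊥±<[ _ ] = ⊥±<[ _ ]
  left {[ r ]} η 0<η ⟦ p ⟧ = let d , 0<d , ev = <-elim r y p in
    ⟦ <-intro r (y + const η) d 0<d (always (λ k r≤ →
        ℚ.≤-trans r≤ (subst (ℚ._≤ seq y k ℚ.+ η) (ℚ.+-identityʳ (seq y k)) (ℚ.+-monoʳ-≤ (seq y k) (ℚ.<⇒≤ 0<η))))
      ⊛ ev) ⟧
  right : ∀ {s} → [ y ] <± s → ∃[ ε ] (0ℚ ℚ.< ε × (∀ η → η ℚ.≤ ε → [ y + const η ] <± s))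
  right [ _ ]<⊤± = 1ℚ , 0<1 , λ _ _ → [ _ ]<⊤±
  right {[ s ]} ⟦ p ⟧ = let d , 0<d , ev = <-elim y s p in
    ½ ℚ.* d , half-pos 0<d , λ η η≤ → ⟦ <-intro (y + const η) s (½ ℚ.* d) (half-pos 0<d) (always (λ k y≤ → begin
      seq y k ℚ.+ η ℚ.+ ½ ℚ.* d          ≤⟨ ℚ.+-monoˡ-≤ (½ ℚ.* d) (ℚ.+-monoʳ-≤ (seq y k) η≤) ⟩
      seq y k ℚ.+ ½ ℚ.* d ℚ.+ ½ ℚ.* d    ≡⟨ solve 2 (λ y d → y :+ con ½ :* d :+ con ½ :* d := y :+ d) refl (seq y k) d ⟩
      seq y k ℚ.+ d                      ≤⟨ y≤ ⟩
      seq s k                            ∎) ⊛ ev) ⟧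
    where open ℚ.≤-Reasoning

-- Values of H at an index of the sequences

at : ℕ → List ℝ → List ℚ
at k = map (λ x → seq x k)

bounded-at : ∀ xs → ∃[ B ] (0ℚ ℚ.≤ B × Eventually (λ k → Bounded B (at k xs)))
bounded-at []       = 0ℚ , ℚ.≤-refl , always (λ _ → [])
bounded-at (x ∷ xs) =
  let A , 0<A , evA = bounded (cauchy x)
      B , 0≤B , evB = bounded-at xs
  in A ℚ.⊔ B , ℚ.≤-trans 0≤B (ℚ.p≤q⊔p A B)
   , (always (λ k a b → ℚ.≤-trans a (ℚ.p≤p⊔q A B) ∷ All.map (λ p → ℚ.≤-trans p (ℚ.p≤q⊔p A B)) b) ⊛ evA ⊛ evB)

-- One-sided form of `Hᴸ-drift`. The lengths enter through equations so that, for lists of terms at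
-- an index `k`, the constant can be written without `k`.
Hᴸ-near : ∀ {m B C δ q} n cs ws y zs → length cs ≡ m → length ws ℕ.+ length zs ≡ n →
  Bounded C cs → Bounded B ws → ∣ y ∣ ℚ.≤ B → Bounded B zs → All (λ w → ∣ w ℚ.- y ∣ ℚ.≤ δ) ws →
  q ℚ.≤ Hᴸ cs (List.replicate (length ws) y ++ zs) →
  q ℚ.- ι (length ws) ℚ.* (δ ℚ.* lip m C n B) ℚ.≤ Hᴸ cs (ws ++ zs)
Hᴸ-near n cs ws y zs refl len bc bw by bz close = lower (Hᴸ-drift n cs ws y zs len bc bw by bz close)

-- Provides the almost constant values that `advance` takes as its hypothesis `near`: all `u + v`
-- leading entries lie within `δ` of `b`.
Hᴸ-near₂ : ∀ {m B C δ q} n cs b c zs u v → length cs ≡ m → (u ℕ.+ v) ℕ.+ length zs ≡ n →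
  Bounded C cs → ∣ b ∣ ℚ.≤ B → ∣ c ∣ ℚ.≤ B → Bounded B zs → ∣ c ℚ.- b ∣ ℚ.≤ δ →
  q ℚ.≤ Hᴸ cs (List.replicate (u ℕ.+ v) b ++ zs) →
  q ℚ.- ι (u ℕ.+ v) ℚ.* (δ ℚ.* lip m C n B) ℚ.≤ Hᴸ cs (List.replicate u c ++ List.replicate v b ++ zs)
Hᴸ-near₂ {m} {B} {C} {δ} {q} n cs b c zs u v lcs len bc bb bcc bz close hyp =
  subst₂ (λ l xs → q ℚ.- ι l ℚ.* (δ ℚ.* lip m C n B) ℚ.≤ Hᴸ cs xs)
    lws (++-assoc (List.replicate u c) (List.replicate v b) zs)
    (Hᴸ-near n cs ws b zs lcs (trans (cong (ℕ._+ length zs) lws) len) bc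
      (All.++⁺ (All.replicate⁺ u bcc) (All.replicate⁺ v bb)) bb bz
      (All.++⁺ (All.replicate⁺ u close) (All.replicate⁺ v b-b))
      (subst (λ l → q ℚ.≤ Hᴸ cs (List.replicate l b ++ zs)) (sym lws) hyp))
  where
  ws = List.replicate u c ++ List.replicate v b
  lws : length ws ≡ u ℕ.+ v
  lws = trans (length-++ (List.replicate u c)) (cong₂ ℕ._+_ (length-replicate u) (length-replicate v))
  b-b : ∣ b ℚ.- b ∣ ℚ.≤ δ
  b-b = ℚ.≤-trans (ℚ.≤-reflexive (cong ∣_∣ (ℚ.+-inverseʳ b))) (ℚ.≤-trans (ℚ.0≤∣p∣ (c ℚ.- b)) close)

-½ε-e : ∀ {ε e} → e ℚ.≤ ½ ℚ.* ε → ℚ.- ε ℚ.≤ ℚ.- (½ ℚ.* ε) ℚ.- e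
-½ε-e {ε} {e} e≤ = begin
  ℚ.- ε                              ≡⟨ solve 1 (λ e → :- e := :- (con ½ :* e) :- con ½ :* e) refl ε ⟩
  ℚ.- (½ ℚ.* ε) ℚ.- ½ ℚ.* ε          ≤⟨ ℚ.+-monoʳ-≤ (ℚ.- (½ ℚ.* ε)) (ℚ.neg-antimono-≤ e≤) ⟩
  ℚ.- (½ ℚ.* ε) ℚ.- e                ∎
  where open ℚ.≤-Reasoning

at-replicate : ∀ k p x xs → at k (List.replicate p x ++ xs) ≡ List.replicate p (seq x k) ++ at k xs
at-replicate k p x xs = trans (map-++ _ (List.replicate p x) xs) (cong (_++ at k xs) (map-replicate _ p x))

valueAt : List ℝ → List ℝ → ℕ → ℚ
valueAt cs xs k = Hᴸ (at k cs) (at k xs)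

valueAt-↭ : ∀ cs {xs ys} → xs ↭ ys → valueAt cs xs ≗ valueAt cs ys
valueAt-↭ cs p k = Hᴸ-↭ (at k cs) (map⁺ _ p)

-- From the diagonal to all points of the interval

module Positivity (cs : List ℝ) (r s : ℝ ±) where

  I : ℝ → Set
  I x = x ∈⟨ r , s ⟩

  value : List ℝ → ℕ → ℚ
  value = valueAt cs

  value-↭ : ∀ {xs ys} → xs ↭ ys → value xs ≗ value ys
  value-↭ = valueAt-↭ cs

  -- The points a + j t (x - a) for j ≤ N + 1, with (N + 1) t = 1.
  module Grid (p : ℕ) (a x : ℝ) (as : List ℝ) {ε B C t : ℚ} (N : ℕ)
    (0≤B : 0ℚ ℚ.≤ B) (0≤C : 0ℚ ℚ.≤ C) (0<t : 0ℚ ℚ.< t) (Nt≡1 : ι (suc N) ℚ.* t ≡ 1ℚ)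
    (small : t ℚ.* (ι (suc p) ℚ.* ((B ℚ.+ B) ℚ.* lip (length cs) C (suc p ℕ.+ length as) B)) ℚ.≤ ½ ℚ.* ε) where

    n : ℕ
    n = suc p ℕ.+ length as

    L : ℚ
    L = lip (length cs) C n B

    g : ℕ → ℚ
    g j = ι j ℚ.* t

    0≤g : ∀ j → 0ℚ ℚ.≤ g j
    0≤g j = *-nonNeg (ι-nonNeg j) (ℚ.<⇒≤ 0<t)

    g≤1 : ∀ {j} → j ≤ℕ suc N → g j ℚ.≤ 1ℚ
    g≤1 {j} j≤N = subst (g j ℚ.≤_) Nt≡1 (ℚ.*-monoʳ-≤-nonNeg t {{ℚ.nonNegative (ℚ.<⇒≤ 0<t)}} (ι-mono j≤N))

    pt : ℕ → ℕ → ℚ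
    pt k j = lerpℚ (g j) (seq a k) (seq x k)

    -- The same `ε` serves for every `j`: a step only forms convex combinations of values that are
    -- at least `-ε`, so errors do not accumulate along the grid.
    Claim : ℕ → ℕ → Set
    Claim j k = ℚ.- ε ℚ.≤ Hᴸ (at k cs) (seq a k ∷ List.replicate p (pt k j) ++ at k as)

    start : ∀ k → ℚ.- ε ℚ.≤ value (List.replicate (suc p) a ++ as) k → Claim 0 k
    start k = subst (ℚ.- ε ℚ.≤_) (cong (Hᴸ (at k cs)) (trans (at-replicate k (suc p) a as)
      (cong (λ b → seq a k ∷ List.replicate p b ++ at k as)
        (solve 3 (λ a t x → a := a :+ (con 0ℚ :* t) :* (x :+ con (ℚ.- 1ℚ) :* a)) refl (seq a k) t (seq x k)))))

    step : ∀ j → suc j ≤ℕ suc N → ∀ k →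
      Bounded B (at k (a ∷ x ∷ as)) → Bounded C (at k cs) →
      ℚ.- (½ ℚ.* ε) ℚ.≤ value (List.replicate (suc p) (lerp (g (suc j)) a x) ++ as) k →
      Claim j k → Claim (suc j) k
    -- The point `pt k j` divides the segment from `a` to `pt k (suc j)` in the ratio `j : 1`, so
    -- `κ` is `ι j`.
    step j j<N k (ba ∷ bx ∷ bas) bc at-b at-c = advance (at k cs) (ι j) (seq a k) b c (at k as) p (ι-nonNeg j)
      (solve 4 (λ κ t a x → let d = x :+ con (ℚ.- 1ℚ) :* a in
         κ :* ((a :+ ((con 1ℚ :+ κ) :* t) :* d) :- (a :+ (κ :* t) :* d)) :+ (a :- (a :+ (κ :* t) :* d)) := con 0ℚ)
         refl (ι j) t (seq a k) (seq x k))
      near at-c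
      where
      b = pt k (suc j)
      c = pt k j
      c-b : ∣ c ℚ.- b ∣ ℚ.≤ t ℚ.* (B ℚ.+ B)
      c-b = subst (λ d → ∣ d ∣ ℚ.≤ t ℚ.* (B ℚ.+ B))
        (solve 4 (λ κ t a x → let d = x :+ con (ℚ.- 1ℚ) :* a in
           t :* (a :- x) := (a :+ (κ :* t) :* d) :- (a :+ ((con 1ℚ :+ κ) :* t) :* d))
           refl (ι j) t (seq a k) (seq x k))
        (∣x*y∣≤ (ℚ.≤-reflexive (ℚ.0≤p⇒∣p∣≡p (ℚ.<⇒≤ 0<t))) (∣x-y∣≤ ba bx))
      near : ∀ u v → u ℕ.+ v ≡ suc p → ℚ.- ε ℚ.≤ Hᴸ (at k cs) (List.replicate u c ++ List.replicate v b ++ at k as)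
      -- One half of `ε` is the tolerance for the constant tuple at `b`, the other half pays for
      -- replacing `c` by `b`.
      near u v uv = ℚ.≤-trans
        (-½ε-e (subst (ℚ._≤ ½ ℚ.* ε)
          (trans (solve 4 (λ t i b l → t :* (i :* (b :* l)) := i :* ((t :* b) :* l)) refl t (ι (suc p)) (B ℚ.+ B) L)
                 (cong (λ l → ι l ℚ.* ((t ℚ.* (B ℚ.+ B)) ℚ.* L)) (sym uv)))
          small))
        (Hᴸ-near₂ n (at k cs) b c (at k as) u v (length-map _ cs)
          (cong₂ ℕ._+_ uv (length-map _ as)) bc
          (∣lerpℚ∣≤ (0≤g (suc j)) (g≤1 j<N) ba bx) (∣lerpℚ∣≤ (0≤g j) (g≤1 (ℕ.<⇒≤ j<N)) ba bx) bas c-b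
          (subst (ℚ.- (½ ℚ.* ε) ℚ.≤_)
            (cong (Hᴸ (at k cs)) (trans (at-replicate k (suc p) (lerp (g (suc j)) a x) as)
              (cong (λ l → List.replicate l b ++ at k as) (sym uv)))) at-b))

    -- The grid is fixed before the index `k`, so only finitely many eventual statements, one for
    -- each grid point, have to hold together.
    reach : Eventually (λ k → Bounded B (at k (a ∷ x ∷ as))) → Eventually (λ k → Bounded C (at k cs)) →
      I a → I x → (∀ y → I y → NonNeg (value (List.replicate (suc p) y ++ as))) → 0ℚ ℚ.< ε →
      ∀ j → j ≤ℕ suc N → Eventually (Claim j)
    reach evB evC a∈ x∈ hyp 0<ε zero    j≤N = always start ⊛ hyp a a∈ ε 0<ε
    reach evB evC a∈ x∈ hyp 0<ε (suc j) j<N = always (step j j<N) ⊛ evB ⊛ evC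
      ⊛ hyp (lerp (g (suc j)) a x) (lerp-∈ r s a x (0≤g (suc j)) (g≤1 j<N) a∈ x∈) (½ ℚ.* ε) (half-pos 0<ε)
      ⊛ reach evB evC a∈ x∈ hyp 0<ε j (ℕ.<⇒≤ j<N)

    finish : ∀ k → Claim (suc N) k → ℚ.- ε ℚ.≤ value (List.replicate p x ++ a ∷ as) k
    finish k = subst (ℚ.- ε ℚ.≤_) (begin
      Hᴸ (at k cs) (seq a k ∷ List.replicate p (pt k (suc N)) ++ at k as)
        ≡⟨ cong (λ b → Hᴸ (at k cs) (seq a k ∷ List.replicate p b ++ at k as)) (trans
             (cong (λ q → lerpℚ q (seq a k) (seq x k)) Nt≡1)
             (solve 2 (λ a x → a :+ con 1ℚ :* (x :+ con (ℚ.- 1ℚ) :* a) := x) refl (seq a k) (seq x k))) ⟩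
      Hᴸ (at k cs) (seq a k ∷ List.replicate p (seq x k) ++ at k as)
        ≡⟨ cong (λ xs → Hᴸ (at k cs) (seq a k ∷ xs)) (at-replicate k p x as) ⟨
      value (a ∷ List.replicate p x ++ as) k
        ≡⟨ value-↭ (shift a (List.replicate p x) as) k ⟨
      value (List.replicate p x ++ a ∷ as) k ∎)
      where open ≡-Reasoning

  nonNeg-step : ∀ p a x as → I a → I x →
    (∀ y → I y → NonNeg (value (List.replicate (suc p) y ++ as))) →
    NonNeg (value (List.replicate p x ++ a ∷ as))
  nonNeg-step p a x as a∈ x∈ hyp ε 0<ε =
    let B , 0≤B , evB = bounded-at (a ∷ x ∷ as)
        C , 0≤C , evC = bounded-at cs
        -- Neighbouring grid points are at most `t (B + B)` apart; the factor supplied here, times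
        -- `t`, bounds the effect of moving `p + 1` entries that far.
        N , t , 0<t , Nt≡1 , small = mesh
          (*-nonNeg (ι-nonNeg (suc p)) (*-nonNeg (ℚ.+-mono-≤ 0≤B 0≤B) (lip-nonNeg (length cs) (suc p ℕ.+ length as) 0≤C 0≤B)))
          (half-pos 0<ε)
        open Grid p a x as {ε} N 0≤B 0≤C 0<t Nt≡1 small
    in always finish ⊛ reach evB evC a∈ x∈ hyp 0<ε (suc N) ℕ.≤-refl

  module _ (n : ℕ) (diagonal : ∀ x → I x → x # 0ℝ → Pos (value (List.replicate n x ++ []))) where

    -- Carries the sign at `y + η` over to `y` with an error of at most `n η L`. The bound `B + 1`
    -- also covers `y + η`, as `η ≤ 1`.
    nudge : ∀ {B C ε t η} k y → 0ℚ ℚ.≤ B → 0ℚ ℚ.≤ C → 0ℚ ℚ.< η → η ℚ.≤ 1ℚ → η ℚ.≤ t →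
      t ℚ.* (ι n ℚ.* lip (length cs) C n (B ℚ.+ 1ℚ)) ℚ.≤ ε →
      Bounded B (at k (y ∷ [])) → Bounded C (at k cs) →
      0ℚ ℚ.≤ value (List.replicate n (y + const η) ++ []) k → ℚ.- ε ℚ.≤ value (List.replicate n y ++ []) k
    nudge {B} {C} {ε} {t} {η} k y 0≤B 0≤C 0<η η≤1 η≤t small (by ∷ []) bc 0≤z = begin
        ℚ.- ε
          ≤⟨ ℚ.neg-antimono-≤ error ⟩
        ℚ.- (ι n ℚ.* (η ℚ.* L))
          ≡⟨ ℚ.+-identityˡ _ ⟨
        0ℚ ℚ.- ι n ℚ.* (η ℚ.* L)
          ≤⟨ subst (λ l → 0ℚ ℚ.≤ Hᴸ (at k cs) (List.replicate l (seq z k) ++ []) →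
                   0ℚ ℚ.- ι l ℚ.* (η ℚ.* L) ℚ.≤ Hᴸ (at k cs) (List.replicate n (seq y k) ++ []))
               (ℕ.+-identityʳ n)
               (Hᴸ-near₂ n (at k cs) (seq z k) (seq y k) [] n 0 (length-map _ cs)
                 (trans (ℕ.+-identityʳ _) (ℕ.+-identityʳ n)) bc
                 (∣x+y∣≤ by (ℚ.≤-trans (ℚ.≤-reflexive ∣η∣) η≤1))
                 (ℚ.≤-trans by (subst (ℚ._≤ B ℚ.+ 1ℚ) (ℚ.+-identityʳ B) (ℚ.+-monoʳ-≤ B (ℚ.<⇒≤ 0<1)))) []
                 (ℚ.≤-reflexive (trans (cong ∣_∣ (solve 2 (λ y h → y :- (y :+ h) := :- h) refl (seq y k) η))
                   (trans (ℚ.∣-p∣≡∣p∣ η) ∣η∣))))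
               (subst (0ℚ ℚ.≤_) (cong (Hᴸ (at k cs)) (at-replicate k n z [])) 0≤z) ⟩
        Hᴸ (at k cs) (List.replicate n (seq y k) ++ [])
          ≡⟨ cong (Hᴸ (at k cs)) (at-replicate k n y []) ⟨
        value (List.replicate n y ++ []) k ∎
      where
      open ℚ.≤-Reasoning
      z = y + const η
      L = lip (length cs) C n (B ℚ.+ 1ℚ)
      ∣η∣ : ∣ η ∣ ≡ η
      ∣η∣ = ℚ.0≤p⇒∣p∣≡p (ℚ.<⇒≤ 0<η)
      error : ι n ℚ.* (η ℚ.* L) ℚ.≤ ε
      error = begin
        ι n ℚ.* (η ℚ.* L)   ≡⟨ solve 3 (λ i h l → i :* (h :* l) := h :* (i :* l)) refl (ι n) η L ⟩
        η ℚ.* (ι n ℚ.* L)   ≤⟨ ℚ.*-monoʳ-≤-nonNeg (ι n ℚ.* L) {{ℚ.nonNegative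
                                 (*-nonNeg (ι-nonNeg n) (lip-nonNeg (length cs) n 0≤C (ℚ.+-mono-≤ 0≤B (ℚ.<⇒≤ 0<1))))}}
                                 η≤t ⟩
        t ℚ.* (ι n ℚ.* L)   ≤⟨ small ⟩
        ε                   ∎

    -- The hypothesis says nothing at 0, but it is not known whether y is 0;
    -- so it is applied to y or to a nearby y + η, whichever is apart from 0.
    diagonal-nonNeg : ∀ y → I y → NonNeg (value (List.replicate n y ++ []))
    diagonal-nonNeg y y∈ ε 0<ε =
      let B , 0≤B , evB = bounded-at (y ∷ [])
          C , 0≤C , evC = bounded-at cs
          ω , 0<ω , shifted∈ = ∈-open r s y y∈
          _ , t , 0<t , _ , small = mesh
            (*-nonNeg (ι-nonNeg n) (lip-nonNeg (length cs) n 0≤C (ℚ.+-mono-≤ 0≤B (ℚ.<⇒≤ 0<1)))) 0<ε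
          ζ , 0<ζ , ζ≤t , ζ≤ω = min-pos 0<t 0<ω
          η , 0<η , η≤ζ , η≤1 = min-pos 0<ζ 0<1
          η≤ω = ℚ.≤-trans η≤ζ ζ≤ω
      in [ (λ y#0 → Pos⇒NonNeg (diagonal y y∈ y#0) ε 0<ε)
         , (λ z#0 → let e , 0<e , ev = diagonal (y + const η) (shifted∈ η 0<η η≤ω) z#0 in
             always (λ k by bc e≤ →
               nudge k y 0≤B 0≤C 0<η η≤1 (ℚ.≤-trans η≤ζ ζ≤t) small by bc (ℚ.≤-trans (ℚ.<⇒≤ 0<e) e≤))
               ⊛ evB ⊛ evC ⊛ ev)
         ]′ (#0-or-shift#0 y 0<η)

    -- Induction on `as`: an entry taken from it is paid for by one more equal entry, so the total
    -- remains `n` and the base case is the diagonal.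
    nonNeg : ∀ as p x → All I as → I x → p ℕ.+ length as ≡ n → NonNeg (value (List.replicate p x ++ as))
    nonNeg [] p x [] x∈ eq =
      subst (λ p → NonNeg (value (List.replicate p x ++ []))) (trans (sym eq) (ℕ.+-identityʳ p)) (diagonal-nonNeg x x∈)
    nonNeg (a ∷ as) p x (a∈ ∷ as∈) x∈ eq = nonNeg-step p a x as a∈ x∈
      (λ y y∈ → nonNeg as (suc p) y as∈ y∈ (trans (sym (ℕ.+-suc p (length as))) eq))

    -- Strict positivity by contraction towards an entry

    module _ (y : ℝ) (y∈ : I y) (N : ℕ) {t : ℚ} (0<t : 0ℚ ℚ.< t) (Nt≡1 : ι (suc N) ℚ.* t ≡ 1ℚ) where

      t≤1 : t ℚ.≤ 1ℚ
      t≤1 = begin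
        t                    ≡⟨ ℚ.*-identityˡ t ⟨
        1ℚ ℚ.* t             ≤⟨ ℚ.*-monoʳ-≤-nonNeg t {{ℚ.nonNegative (ℚ.<⇒≤ 0<t)}} (ι-mono {1} {suc N} (ℕ.s≤s ℕ.z≤n)) ⟩
        ι (suc N) ℚ.* t      ≡⟨ Nt≡1 ⟩
        1ℚ                   ∎
        where open ℚ.≤-Reasoning

      toward : ℝ → ℝ
      toward x = lerp t y x

      toward-∈ : ∀ {x} → I x → I (toward x)
      toward-∈ {x} = lerp-∈ r s y x (ℚ.<⇒≤ 0<t) t≤1 y∈

      -- The point `toward x` divides the segment from `x` to `y` in the ratio `N : 1`. Knot
      -- insertion thus gives the value at `y`, `x` a positive share of the value at `y`,
      -- `toward x`, while the other share is nonnegative by `nonNeg`.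
      release-one : ∀ x zs → I x → All I zs → 2 ℕ.+ length zs ≡ n →
        Pos (value (y ∷ toward x ∷ zs)) → Pos (value (y ∷ x ∷ zs))
      release-one x zs x∈ zs∈ len (e , 0<e , ev) =
        -- With `(N + 1) d = e / 2` the sum in knot insertion is at least `e - N d`, which is at
        -- least `(N + 1) d`.
        let d , 0<d , Md≡ = divide (ι N ℚ.+ 1ℚ) (½ ℚ.* e) (ℚ.+-mono-≤-< (ι-nonNeg N) 0<1) (half-pos 0<e)
        in d , 0<d , (always (pointwise d 0<d Md≡) ⊛ ev
             -- With `p = 0` all `n` entries are taken from the list.
             ⊛ nonNeg (x ∷ toward x ∷ zs) 0 x (x∈ ∷ toward-∈ x∈ ∷ zs∈) x∈ len d 0<d)
        where
        pointwise : ∀ d → 0ℚ ℚ.< d → (ι N ℚ.+ 1ℚ) ℚ.* d ≡ ½ ℚ.* e → ∀ k →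
          e ℚ.≤ value (y ∷ toward x ∷ zs) k → ℚ.- d ℚ.≤ value (x ∷ toward x ∷ zs) k →
          d ℚ.≤ value (y ∷ x ∷ zs) k
        pointwise d 0<d Md≡ k e≤ -d≤ =
          ℚ.*-cancelˡ-≤-pos (ι N ℚ.+ 1ℚ) {{ℚ.positive (ℚ.+-mono-≤-< (ι-nonNeg N) 0<1)}} (begin
            (ι N ℚ.+ 1ℚ) ℚ.* d
              ≡⟨ Md≡ ⟩
            ½ ℚ.* e
              ≡⟨ solve 1 (λ e → con ½ :* e := :- (con ½ :* e) :+ e) refl e ⟩
            ℚ.- (½ ℚ.* e) ℚ.+ e
              ≡⟨ cong (λ m → ℚ.- m ℚ.+ e) Md≡ ⟨
            ℚ.- ((ι N ℚ.+ 1ℚ) ℚ.* d) ℚ.+ e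
              ≡⟨ solve 3 (λ i d e → :- ((i :+ con 1ℚ) :* d) :+ e := (i :* :- d :+ e) :- d) refl (ι N) d e ⟩
            (ι N ℚ.* ℚ.- d ℚ.+ e) ℚ.- d
              ≤⟨ ℚ.+-monoʳ-≤ (ι N ℚ.* ℚ.- d ℚ.+ e) (ℚ.neg-antimono-≤ (ℚ.<⇒≤ 0<d)) ⟩
            (ι N ℚ.* ℚ.- d ℚ.+ e) ℚ.- 0ℚ
              ≡⟨ ℚ.+-identityʳ _ ⟩
            ι N ℚ.* ℚ.- d ℚ.+ e
              ≤⟨ ℚ.+-mono-≤ (*-monoʳ-≤ (ι N) (ι-nonNeg N) -d≤) e≤ ⟩
            ι N ℚ.* value (x ∷ toward x ∷ zs) k ℚ.+ value (y ∷ toward x ∷ zs) k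
              ≡⟨ cong (ι N ℚ.* value (x ∷ toward x ∷ zs) k ℚ.+_) (value-↭ (swap y (toward x) Perm.refl) k) ⟩
            ι N ℚ.* value (x ∷ toward x ∷ zs) k ℚ.+ value (toward x ∷ y ∷ zs) k
              ≡⟨ knot-insertion (at k cs) (ι N) (seq x k) (seq y k) (seq (toward x) k) (at k zs) balance ⟨
            (ι N ℚ.+ 1ℚ) ℚ.* value (x ∷ y ∷ zs) k
              ≡⟨ cong ((ι N ℚ.+ 1ℚ) ℚ.*_) (value-↭ (swap x y Perm.refl) k) ⟩
            (ι N ℚ.+ 1ℚ) ℚ.* value (y ∷ x ∷ zs) k ∎)
          where
          open ℚ.≤-Reasoning
          balance : ι N ℚ.* (seq y k ℚ.- seq (toward x) k) ℚ.+ (seq x k ℚ.- seq (toward x) k) ≡ 0ℚ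
          balance = begin-equality
            ι N ℚ.* (seq y k ℚ.- seq (toward x) k) ℚ.+ (seq x k ℚ.- seq (toward x) k)
              ≡⟨ solve 4 (λ i t y x → let c = y :+ t :* (x :+ con (ℚ.- 1ℚ) :* y) in
                   i :* (y :- c) :+ (x :- c) := (x :- y) :* (con 1ℚ :- (con 1ℚ :+ i) :* t))
                   refl (ι N) t (seq y k) (seq x k) ⟩
            (seq x k ℚ.- seq y k) ℚ.* (1ℚ ℚ.- ι (suc N) ℚ.* t)
              ≡⟨ cong (λ u → (seq x k ℚ.- seq y k) ℚ.* (1ℚ ℚ.- u)) Nt≡1 ⟩
            (seq x k ℚ.- seq y k) ℚ.* 0ℚ
              ≡⟨ ℚ.*-zeroʳ (seq x k ℚ.- seq y k) ⟩
            0ℚ ∎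

      -- `ws` collects the entries already released; symmetry of H carries each of them there and
      -- back into its place.
      release : ∀ xs ws → All I xs → All I ws → suc (length xs ℕ.+ length ws) ≡ n →
        Pos (value (y ∷ map toward xs ++ ws)) → Pos (value (y ∷ xs ++ ws))
      release []       ws xs∈        ws∈ len pos = pos
      release (x ∷ xs) ws (x∈ ∷ xs∈) ws∈ len pos =
        Pos-resp (value-↭ (prep y (shift x xs ws)))
          (release xs (x ∷ ws) xs∈ (x∈ ∷ ws∈) (trans (cong suc (ℕ.+-suc (length xs) (length ws))) len)
            (Pos-resp (value-↭ (prep y (↭-sym (shift x (map toward xs) ws))))
              (release-one x (map toward xs ++ ws) x∈
                (All.++⁺ (All.map⁺ (All.map toward-∈ xs∈)) ws∈)
                (trans (cong (2 ℕ.+_) (trans (length-++ (map toward xs)) (cong (ℕ._+ length ws) (length-map toward xs)))) len)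
                pos)))

      -- The contracted entries lie within `t (B + B)` of `y`, so the value falls short of the
      -- diagonal bound `e` by at most half of it.
      gathered : ∀ {B C e} xs → suc (length xs) ≡ n →
        t ℚ.* (ι n ℚ.* ((B ℚ.+ B) ℚ.* lip (length cs) C n B)) ℚ.≤ ½ ℚ.* e → ∀ k →
        Bounded B (at k (y ∷ xs)) → Bounded C (at k cs) →
        e ℚ.≤ value (List.replicate n y ++ []) k → ½ ℚ.* e ℚ.≤ value (y ∷ map toward xs ++ []) k
      gathered {B} {C} {e} xs refl small k (by ∷ bxs) bc e≤ = begin
        ½ ℚ.* e
          ≡⟨ solve 1 (λ e → con ½ :* e := e :- con ½ :* e) refl e ⟩
        e ℚ.- ½ ℚ.* e
          ≤⟨ ℚ.+-monoʳ-≤ e (ℚ.neg-antimono-≤ small) ⟩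
        e ℚ.- t ℚ.* (ι n ℚ.* ((B ℚ.+ B) ℚ.* L))
          ≡⟨ cong (λ d → e ℚ.- d) (solve 4 (λ t i b l → t :* (i :* (b :* l)) := i :* ((t :* b) :* l)) refl t (ι n) (B ℚ.+ B) L) ⟩
        e ℚ.- ι n ℚ.* ((t ℚ.* (B ℚ.+ B)) ℚ.* L)
          ≡⟨ cong (λ l → e ℚ.- ι l ℚ.* ((t ℚ.* (B ℚ.+ B)) ℚ.* L)) lws ⟨
        e ℚ.- ι (length ws) ℚ.* ((t ℚ.* (B ℚ.+ B)) ℚ.* L)
          ≤⟨ Hᴸ-near n (at k cs) ws (seq y k) [] (length-map _ cs) (trans (ℕ.+-identityʳ _) lws) bc
               (by ∷ bws) by [] (y-y ∷ close)
               (subst (e ℚ.≤_) (cong (Hᴸ (at k cs))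
                 (trans (at-replicate k n y []) (cong (λ l → List.replicate l (seq y k) ++ []) (sym lws)))) e≤) ⟩
        Hᴸ (at k cs) (ws ++ [])
          ≡⟨ cong (Hᴸ (at k cs)) (map-++ (λ x → seq x k) (y ∷ map toward xs) []) ⟨
        value (y ∷ map toward xs ++ []) k ∎
        where
        open ℚ.≤-Reasoning
        L = lip (length cs) C n B
        ws = at k (y ∷ map toward xs)
        lws : length ws ≡ n
        lws = cong suc (trans (length-map _ (map toward xs)) (length-map toward xs))
        bws : Bounded B (at k (map toward xs))
        bws = All.map⁺ (All.map⁺ (All.map (∣lerpℚ∣≤ (ℚ.<⇒≤ 0<t) t≤1 by) (All.map⁻ bxs)))
        step≤ : ∀ {x} → ∣ x ∣ ℚ.≤ B → ∣ lerpℚ t (seq y k) x ℚ.- seq y k ∣ ℚ.≤ t ℚ.* (B ℚ.+ B)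
        step≤ {x} bx = subst (λ d → ∣ d ∣ ℚ.≤ t ℚ.* (B ℚ.+ B))
          (solve 3 (λ t y x → t :* (x :- y) := (y :+ t :* (x :+ con (ℚ.- 1ℚ) :* y)) :- y) refl t (seq y k) x)
          (∣x*y∣≤ (ℚ.≤-reflexive (ℚ.0≤p⇒∣p∣≡p (ℚ.<⇒≤ 0<t))) (∣x-y∣≤ bx by))
        close : All (λ w → ∣ w ℚ.- seq y k ∣ ℚ.≤ t ℚ.* (B ℚ.+ B)) (at k (map toward xs))
        close = All.map⁺ (All.map⁺ (All.map step≤ (All.map⁻ bxs)))
        y-y : ∣ seq y k ℚ.- seq y k ∣ ℚ.≤ t ℚ.* (B ℚ.+ B)
        y-y = subst (λ x → ∣ x ℚ.- seq y k ∣ ℚ.≤ t ℚ.* (B ℚ.+ B)) (lerpℚ-diag t (seq y k)) (step≤ by)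

    pos : ∀ y xs → I y → All I xs → y # 0ℝ → suc (length xs) ≡ n → Pos (value (y ∷ xs))
    pos y xs y∈ xs∈ y#0 len =
      let e , 0<e , ev = diagonal y y∈ y#0
          B , 0≤B , evB = bounded-at (y ∷ xs)
          C , 0≤C , evC = bounded-at cs
          -- The contraction factor `t` is chosen after the lower bound `e` at the diagonal point.
          N , t , 0<t , Nt≡1 , small = mesh
            (*-nonNeg (ι-nonNeg n) (*-nonNeg (ℚ.+-mono-≤ 0≤B 0≤B) (lip-nonNeg (length cs) n 0≤C 0≤B)))
            (half-pos 0<e)
      in subst (λ zs → Pos (value (y ∷ zs))) (++-identityʳ xs)
           (release y y∈ N 0<t Nt≡1 xs [] xs∈ [] (trans (cong suc (ℕ.+-identityʳ _)) len)
             (½ ℚ.* e , half-pos 0<e , (always (gathered y y∈ N 0<t Nt≡1 xs len small) ⊛ evB ⊛ evC ⊛ ev)))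

-- The equivalence for vectors of reals

tabulate-replicate : ∀ {A : Set} n (x : A) → tabulate (replicate n x) ≡ List.replicate n x
tabulate-replicate zero    x = refl
tabulate-replicate (suc n) x = cong (x ∷_) (tabulate-replicate n x)

theorem3 : (n m : ℕ) → 1 ≤ℕ n →
    (c : Vector ℝ (suc m)) →
    (r s : ℝ ±) → r <± s →
    ((a : Vector ℝ n) → (∀ i → a i ∈⟨ r , s ⟩) → (∃[ i ] a i # 0ℝ) → 0ℝ < H c a)
    ⇔
    ((x : ℝ) → x ∈⟨ r , s ⟩ → x # 0ℝ → 0ℝ < H c (replicate n x))
theorem3 n@(suc _) m (ℕ.s≤s _) c r s r<s = mk⇔
  -- Because `n ≥ 1`, the index `zero` exists and shows that the constant vector is apart from 0.
  (λ hyp x x∈ x#0 → hyp (replicate n x) (λ _ → x∈) (zero , x#0))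
  (λ hyp a a∈ (i , ai#0) →
    -- By symmetry the entry apart from 0 is moved to the front, where `Positivity.pos` expects it.
    let ys , zs , eq = ∈-∃++ (∈-tabulate⁺ {f = a} i)
        split : tabulate a ↭ a i ∷ ys ++ zs
        split = ↭-trans (↭-reflexive eq) (shift (a i) ys zs)
        diagonal : ∀ x → x ∈⟨ r , s ⟩ → x # 0ℝ → Pos (valueAt cs (List.replicate n x ++ []))
        diagonal x x∈ x#0 = Pos-resp
          (λ k → trans (seq-value (replicate n x) k) (cong (λ xs → valueAt cs xs k)
            (trans (tabulate-replicate n x) (sym (++-identityʳ _)))))
          (0<⇒Pos (H c (replicate n x)) (hyp x x∈ x#0))
    in Pos⇒0< (H c a) (Pos-resp
         (λ k → sym (trans (seq-value a k) (valueAt-↭ cs split k)))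
         (Positivity.pos cs r s n diagonal (a i) (ys ++ zs) (a∈ i)
           (All.tail (All-resp-↭ split (All.tabulate⁺ a∈))) ai#0
           (trans (sym (↭-length split)) (length-tabulate a)))))
  where
  cs = tabulate c
  seq-value : ∀ (a : Vector ℝ n) k → seq (H c a) k ≡ valueAt cs (tabulate a) k
  seq-value a k = trans (seq-H k c a) (sym (cong₂ Hᴸ (map-tabulate c (λ x → seq x k)) (map-tabulate a (λ x → seq x k))))
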